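{- Let $q$ be a prime power, let $m,n\ge 1$, and let $\mathcal{C}$ be a nondegenerate $[n,k,d]_{q^m/q}$ code with generator matrix $G\in\mathbb{F}_{q^m}^{k\times n}$. The following statements are equivalent: (1) The code $\mathcal{C}$ is rank-metric intersecting. (2) For all $A\in\mathrm{GL}(n,q)$, the code $\mathcal{C}\cdot A=\{cA : c\in\mathcal{C}\}$ is Hamming-metric intersecting. (3) For all $A\in\mathrm{GL}(n,q)$, the multiset $\mathcal{S}$ of points of $\mathrm{PG}(k-1,q^m)$ obtained by identifying the columns of $G\cdot A$ with points of the projective space is not contained in the union of two hyperplanes. (4) The $[n,k]_{q^m/q}$ system $\mathcal{U}$ corresponding to $\mathcal{C}$, i.e. the $\mathbb{F}_q$-span in $\mathbb{F}_{q^m}^k$ of the columns of $G$, is not $2$-spannable.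
   Context: Support and rank: fix an $\mathbb{F}_q$-basis $\Gamma$ of $\mathbb{F}_{q^m}$. For $x=(x_1,\dots,x_n)\in\mathbb{F}_{q^m}^n$ let $\mathrm{Mat}_\Gamma(x)\in\mathbb{F}_q^{m\times n}$ be the matrix whose $j$-th column is the coordinate vector of $x_j$ in the basis $\Gamma$. The support $\sigma(x)\subseteq\mathbb{F}_q^n$ is the $\mathbb{F}_q$-row space of $\mathrm{Mat}_\Gamma(x)$, and $\mathrm{rk}(x)=\dim_{\mathbb{F}_q}\sigma(x)$; both are independent of $\Gamma$. An $[n,k,d]_{q^m/q}$ code is an $\mathbb{F}_{q^m}$-linear subspace $\mathcal{C}$ of $\mathbb{F}_{q^m}^n$ with $k=\dim_{\mathbb{F}_{q^m}}\mathcal{C}\ge 1$ and minimum distance $d=\min_{c\in\mathcal{C}\setminus\{0\}}\mathrm{rk}(c)$. A generator matrix is a $k\times n$ matrix over $\mathbb{F}_{q^m}$ whose row space is $\mathcal{C}$. The code is nondegenerate if $\sum_{c\in\mathcal{C}}\sigma(c)=\mathbb{F}_q^n$ (equivalently, the columns of a generator matrix are $\mathbb{F}_q$-linearly independent). The code is rank-metric intersecting if $\sigma(c)\cap\sigma(c')\ne\{0\}$ for all $c,c'\in\mathcal{C}\setminus\{0\}$. A linear code is Hamming-metric intersecting if for any two nonzero codewords $c,c'$ there is a coordinate $i$ with $c_i\ne 0$ and $c'_i\neq 0$. An $[n,k]_{q^m/q}$ system is an $\mathbb{F}_q$-subspace $\mathcal{U}\subseteq\mathbb{F}_{q^m}^k$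 of $\mathbb{F}_q$-dimension $n$ with $\langle\mathcal{U}\rangle_{\mathbb{F}_{q^m}}=\mathbb{F}_{q^m}^k$. It is $2$-spannable if there exist two $\mathbb{F}_{q^m}$-linear hyperplanes $\mathcal{H}_1,\mathcal{H}_2$ of $\mathbb{F}_{q^m}^k$ such that $\mathcal{U}=(\mathcal{H}_1\cap\mathcal{U})+(\mathcal{H}_2\cap\mathcal{U})$. -}

module Defs where

open import Level using (Level; _⊔_) renaming (suc to lsuc)
open import Algebra.Bundles using (Ring; CommutativeRing)
open import Algebra.Module.Bundles using (LeftModule)
open import Algebra.Morphism.Structures using (module RingMorphisms)
import Algebra.Module.Construct.TensorUnit as TensorUnit
import Algebra.Properties.Monoid.Sum as MonoidSum
import Algebra.Properties.Semiring.Sum as SemiringSum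
open import Data.Bool.Base using (if_then_else_)
open import Data.Fin.Base using (Fin; zero; suc)
import Data.Fin.Properties as Fin
open import Data.Nat.Base using (ℕ; zero; suc; pred; _^_; _≤_)
open import Data.Nat.Primality using (Prime)
open import Data.Product.Base using (Σ; ∃; ∃-syntax; ∃₂; _×_; _,_; proj₁; proj₂)
open import Data.Sum.Base using (_⊎_)
open import Data.Vec.Functional using (Vector)
open import Function.Base using (_∘_)
open import Function.Bundles using (Inverse)
open import Relation.Binary.Bundles using (Setoid)
open import Relation.Binary.PropositionalEquality.Core as ≡ using (_≡_)
import Relation.Binary.PropositionalEquality.Properties as ≡
import Relation.Binary.Reasoning.Setoid as SetoidReasoning
open import Relation.Nullary.Decidable.Core using (does; yes; no)
open import Relation.Nullary.Negation.Core using (¬_; contradiction)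
open import Relation.Unary using (Pred; _∈_; _∩_; _≐_; U)

IsPrimePower : ℕ → Set
IsPrimePower q = ∃₂ λ p e → Prime p × q ≡ p ^ suc e

HasOrder : ∀ {a b} → Setoid a b → ℕ → Set (a ⊔ b)
HasOrder S q = Inverse S (≡.setoid (Fin q))

record IsField {c ℓ} (K : CommutativeRing c ℓ) : Set (c ⊔ ℓ) where
  open CommutativeRing K
  field
    1≉0     : 1# ≉ 0#
    inverse : ∀ x → x ≉ 0# → ∃[ y ] x * y ≈ 1#

Matrix : ∀ {a} → Set a → ℕ → ℕ → Set a
Matrix A r s = Fin r → Fin s → A

column : ∀ {a} {A : Set a} {r s} → Matrix A r s → Fin s → Vector A r
column M j i = M i j

power : ∀ {r ℓr m ℓm} {R : Ring r ℓr} → LeftModule R m ℓm → ℕ → LeftModule R m ℓm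
power {R = R} V n = record
  { Carrierᴹ = Vector V.Carrierᴹ n
  ; _≈ᴹ_     = λ x y → ∀ i → x i V.≈ᴹ y i
  ; _+ᴹ_     = λ x y i → x i V.+ᴹ y i
  ; _*ₗ_     = λ a x i → a V.*ₗ x i
  ; 0ᴹ       = λ _ → V.0ᴹ
  ; -ᴹ_      = λ x i → V.-ᴹ (x i)
  ; isLeftModule = record
    { isLeftSemimodule = record
      { +ᴹ-isCommutativeMonoid = record
        { isMonoid = record
          { isSemigroup = record
            { isMagma = record
              { isEquivalence = record
                { refl  = λ _ → V.≈ᴹ-refl
                ; sym   = λ p i → V.≈ᴹ-sym (p i)
                ; trans = λ p q i → V.≈ᴹ-trans (p i) (q i)
                }
              ; ∙-cong = λ p q i → V.+ᴹ-cong (p i) (q i)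
              }
            ; assoc = λ x y z i → V.+ᴹ-assoc (x i) (y i) (z i)
            }
          ; identity = (λ x i → V.+ᴹ-identityˡ (x i)) , (λ x i → V.+ᴹ-identityʳ (x i))
          }
        ; comm = λ x y i → V.+ᴹ-comm (x i) (y i)
        }
      ; isPreleftSemimodule = record
        { *ₗ-cong      = λ a≈b p i → V.*ₗ-cong a≈b (p i)
        ; *ₗ-zeroˡ     = λ x i → V.*ₗ-zeroˡ (x i)
        ; *ₗ-distribʳ  = λ x a b i → V.*ₗ-distribʳ (x i) a b
        ; *ₗ-identityˡ = λ x i → V.*ₗ-identityˡ (x i)
        ; *ₗ-assoc     = λ a b x i → V.*ₗ-assoc a b (x i)
        ; *ₗ-zeroʳ     = λ a i → V.*ₗ-zeroʳ a
        ; *ₗ-distribˡ  = λ a x y i → V.*ₗ-distribˡ a (x i) (y i)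
        }
      }
    ; -ᴹ‿cong    = λ p i → V.-ᴹ‿cong (p i)
    ; -ᴹ‿inverse = (λ x i → V.-ᴹ‿inverseˡ (x i)) , (λ x i → V.-ᴹ‿inverseʳ (x i))
    }
  }
  where module V = LeftModule V

module _ {c₁ ℓ₁ c₂ ℓ₂} (R : Ring c₁ ℓ₁) (S : Ring c₂ ℓ₂) where
  private
    module R = Ring R
    module S = Ring S
  open RingMorphisms R.rawRing S.rawRing using (IsRingHomomorphism; module IsRingHomomorphism)

  restrictScalars : ∀ {m ℓm} (f : R.Carrier → S.Carrier) → IsRingHomomorphism f →
                    LeftModule S m ℓm → LeftModule R m ℓm
  restrictScalars f isHom V = record
    { Carrierᴹ = V.Carrierᴹ
    ; _≈ᴹ_     = V._≈ᴹ_
    ; _+ᴹ_     = V._+ᴹ_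
    ; _*ₗ_     = λ a x → f a V.*ₗ x
    ; 0ᴹ       = V.0ᴹ
    ; -ᴹ_      = V.-ᴹ_
    ; isLeftModule = record
      { isLeftSemimodule = record
        { +ᴹ-isCommutativeMonoid = V.+ᴹ-isCommutativeMonoid
        ; isPreleftSemimodule = record
          { *ₗ-cong      = λ a≈b p → V.*ₗ-cong (f.⟦⟧-cong a≈b) p
          ; *ₗ-zeroˡ     = λ x → V.≈ᴹ-trans (V.*ₗ-congʳ f.0#-homo) (V.*ₗ-zeroˡ x)
          ; *ₗ-distribʳ  = λ x a b → V.≈ᴹ-trans (V.*ₗ-congʳ (f.+-homo a b))
                                                (V.*ₗ-distribʳ x (f a) (f b))
          ; *ₗ-identityˡ = λ x → V.≈ᴹ-trans (V.*ₗ-congʳ f.1#-homo) (V.*ₗ-identityˡ x)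
          ; *ₗ-assoc     = λ a b x → V.≈ᴹ-trans (V.*ₗ-congʳ (f.*-homo a b))
                                                (V.*ₗ-assoc (f a) (f b) x)
          ; *ₗ-zeroʳ     = λ a → V.*ₗ-zeroʳ (f a)
          ; *ₗ-distribˡ  = λ a → V.*ₗ-distribˡ (f a)
          }
        }
      ; -ᴹ‿cong    = V.-ᴹ‿cong
      ; -ᴹ‿inverse = V.-ᴹ‿inverse
      }
    }
    where
    module V = LeftModule V
    module f = IsRingHomomorphism isHom

-- Subspaces are represented by predicates on vectors.
module LinearAlgebra {r ℓr m ℓm} {R : Ring r ℓr} (V : LeftModule R m ℓm) where
  open Ring R using (Carrier; _≈_; 0#)
  open LeftModule V
  open MonoidSum +ᴹ-monoid public using () renaming (sum to sumᴹ)

  record IsSubspace {p} (P : Pred Carrierᴹ p) : Set (r ⊔ m ⊔ ℓm ⊔ p) where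
    field
      respects  : ∀ {x y} → x ≈ᴹ y → x ∈ P → y ∈ P
      0-closed  : 0ᴹ ∈ P
      +-closed  : ∀ {x y} → x ∈ P → y ∈ P → (x +ᴹ y) ∈ P
      *ₗ-closed : ∀ a {x} → x ∈ P → (a *ₗ x) ∈ P

  IsZero : Pred Carrierᴹ ℓm
  IsZero x = x ≈ᴹ 0ᴹ

  lincomb : ∀ {s} → Vector Carrier s → Vector Carrierᴹ s → Carrierᴹ
  lincomb a v = sumᴹ (λ i → a i *ₗ v i)

  Span : ∀ {s} → Vector Carrierᴹ s → Pred Carrierᴹ (r ⊔ ℓm)
  Span v x = ∃[ a ] x ≈ᴹ lincomb a v

  LinearlyIndependent : ∀ {s} → Vector Carrierᴹ s → Set (r ⊔ ℓr ⊔ ℓm)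
  LinearlyIndependent v = ∀ a → lincomb a v ≈ᴹ 0ᴹ → ∀ i → a i ≈ 0#

  IsBasis : ∀ {p s} → Vector Carrierᴹ s → Pred Carrierᴹ p → Set (r ⊔ ℓr ⊔ m ⊔ ℓm ⊔ p)
  IsBasis v P = LinearlyIndependent v × Span v ≐ P

  HasDimension : ∀ {p} → Pred Carrierᴹ p → ℕ → Set (r ⊔ ℓr ⊔ m ⊔ ℓm ⊔ p)
  HasDimension P s = Σ (Vector Carrierᴹ s) λ v → IsBasis v P

  infixl 6 _⊞_
  _⊞_ : ∀ {p₁ p₂} → Pred Carrierᴹ p₁ → Pred Carrierᴹ p₂ → Pred Carrierᴹ (m ⊔ ℓm ⊔ p₁ ⊔ p₂)
  (P ⊞ Q) x = ∃₂ λ y z → y ∈ P × z ∈ Q × x ≈ᴹ y +ᴹ z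

  -- The family may be infinite or have repeated members; an element of its sum
  -- is a finite sum of elements of members.
  FamilySum : ∀ {i p} {I : Set i} → (I → Pred Carrierᴹ p) → Pred Carrierᴹ (m ⊔ ℓm ⊔ i ⊔ p)
  FamilySum {I = I} P x =
    ∃[ s ] Σ (Vector I s) λ is → Σ (Vector Carrierᴹ s) λ v →
      (∀ t → v t ∈ P (is t)) × x ≈ᴹ sumᴹ v

module _ {c ℓ} (K : CommutativeRing c ℓ) where
  open CommutativeRing K
  open SemiringSum semiring using (sum)

  infixl 7 _⊗_
  _⊗_ : ∀ {r s t} → Matrix Carrier r s → Matrix Carrier s t → Matrix Carrier r t
  (M ⊗ N) i j = sum (λ l → M i l * N l j)

  identityMatrix : ∀ n → Matrix Carrier n n
  identityMatrix n i j = if does (i Fin.≟ j) then 1# else 0#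

  record GL (n : ℕ) : Set (c ⊔ ℓ) where
    field
      matrix   : Matrix Carrier n n
      matrix⁻¹ : Matrix Carrier n n
      inverseˡ : ∀ i j → (matrix⁻¹ ⊗ matrix) i j ≈ identityMatrix n i j
      inverseʳ : ∀ i j → (matrix ⊗ matrix⁻¹) i j ≈ identityMatrix n i j

coordinateSpace : ∀ {c ℓ} (K : CommutativeRing c ℓ) → ℕ →
                  LeftModule (CommutativeRing.ring K) c ℓ
coordinateSpace K = power (TensorUnit.leftModule {R = CommutativeRing.ring K})

module _ {c ℓ} (K : CommutativeRing c ℓ) where
  open CommutativeRing K
  private
    K^_ : ℕ → LeftModule ring c ℓ
    K^_ = coordinateSpace K

  -- Meaningful for k ≥ 1 only, as pred 0 = 0.
  record IsHyperplane {p} (k : ℕ) (H : Pred (Vector Carrier k) p) : Set (c ⊔ ℓ ⊔ p) where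
    open LinearAlgebra (K^ k)
    field
      isSubspace : IsSubspace H
      codim1     : HasDimension H (pred k)

  -- PG isField k is PG(k-1, K): nonzero vectors of K^k up to a nonzero scalar.
  PG : IsField K → ℕ → Setoid (c ⊔ ℓ) (c ⊔ ℓ)
  PG isField k = record
    { Carrier = ∃[ v ] ¬ (v ≈ᴹ 0ᴹ)
    ; _≈_     = λ (v , _) (w , _) → ∃[ a ] ¬ (a ≈ 0#) × w ≈ᴹ (a *ₗ v)
    ; isEquivalence = record
      { refl  = 1# , 1≉0 , λ i → sym (*-identityˡ _)
      ; sym   = λ {(_ , _)} {(_ , w≉0)} (a , a≉0 , eq) →
          let (b , ab≈1) = inverse a a≉0 in
          b
          , (λ b≈0 → 1≉0 (trans (sym ab≈1) (trans (*-congˡ b≈0) (zeroʳ a))))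
          , λ i → sym (trans (*-congˡ (eq i)) (trans (sym (*-assoc b a _))
                    (trans (*-congʳ (trans (*-comm b a) ab≈1)) (*-identityˡ _))))
      ; trans = λ (a , a≉0 , eq) (b , b≉0 , eq′) →
          b * a
          , (λ ba≈0 → let (b′ , bb′≈1) = inverse b b≉0 in
               a≉0 (trans (sym (*-identityˡ a))
                   (trans (*-congʳ (trans (sym bb′≈1) (*-comm b b′)))
                   (trans (*-assoc b′ b a) (trans (*-congˡ ba≈0) (zeroʳ b′))))))
          , λ i → trans (eq′ i) (trans (*-congˡ (eq i)) (sym (*-assoc b a _)))
      }
    }
    where
    open LeftModule (K^ k) using (_≈ᴹ_; 0ᴹ; _*ₗ_)
    open IsField isField

  -- A multiset of n points is a family indexed by Fin n.  Whether the point of v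
  -- lies in H does not depend on the representative v, H being a linear subspace.
  ContainedInTwoHyperplanes : (isField : IsField K) → ∀ {k n} →
                              Vector (Setoid.Carrier (PG isField k)) n → Set (lsuc (c ⊔ ℓ))
  ContainedInTwoHyperplanes _ {k} 𝒮 =
    Σ (Pred (Vector Carrier k) (c ⊔ ℓ)) λ H₁ → Σ (Pred (Vector Carrier k) (c ⊔ ℓ)) λ H₂ →
      IsHyperplane k H₁ × IsHyperplane k H₂ ×
      (∀ j → proj₁ (𝒮 j) ∈ H₁ ⊎ proj₁ (𝒮 j) ∈ H₂)

-- The inclusion ι of the field F with q elements into the field L with q ^ m elements.
record FiniteFieldExtension (c ℓ : Level) (q m : ℕ) : Set (lsuc (c ⊔ ℓ)) where
  field
    F L       : CommutativeRing c ℓ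
    F-isField : IsField F
    L-isField : IsField L

  module F = CommutativeRing F
  module L = CommutativeRing L
  open RingMorphisms F.rawRing L.rawRing using (IsRingHomomorphism; module IsRingHomomorphism)

  field
    F-order : HasOrder F.setoid q
    L-order : HasOrder L.setoid (q ^ m)
    ι       : F.Carrier → L.Carrier
    ι-isHom : IsRingHomomorphism ι

  module ι = IsRingHomomorphism ι-isHom

  L-over-F : LeftModule F.ring c ℓ
  L-over-F = restrictScalars F.ring L.ring ι ι-isHom (TensorUnit.leftModule {R = L.ring})

  F^_ : ℕ → LeftModule F.ring c ℓ
  F^_ = coordinateSpace F

  L^_ : ℕ → LeftModule L.ring c ℓ
  L^_ = coordinateSpace L

  L^_-over-F : ℕ → LeftModule F.ring c ℓ
  L^ n -over-F = restrictScalars F.ring L.ring ι ι-isHom (L^ n)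

  FBasis : Set (c ⊔ ℓ)
  FBasis = ∃[ Γ ] LinearAlgebra.IsBasis L-over-F {s = m} Γ U

module RankMetric {c ℓ q m} (E : FiniteFieldExtension c ℓ q m)
                  (Γ : FiniteFieldExtension.FBasis E) where
  open FiniteFieldExtension E
  private
    module Fⁿ {n} = LinearAlgebra (F^ n)
    module Lⁿ {n} = LinearAlgebra (L^ n)
    module LF {n} = LinearAlgebra (L^ n -over-F)

  -- The coordinates come from the spanning property of Γ; they are unique, Γ being
  -- linearly independent.
  Mat : ∀ {n} → Vector L.Carrier n → Matrix F.Carrier m n
  Mat x i j = coordinates (x j) i
    where
    coordinates : L.Carrier → Vector F.Carrier m
    coordinates y = proj₁ (proj₂ (proj₂ (proj₂ Γ)) {y} _)

  σ : ∀ {n} → Vector L.Carrier n → Pred (Vector F.Carrier n) (c ⊔ ℓ)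
  σ x = Fⁿ.Span (Mat x)

  HasRank : ∀ {n} → Vector L.Carrier n → ℕ → Set (c ⊔ ℓ)
  HasRank x = Fⁿ.HasDimension (σ x)

  IsMinimumDistance : ∀ {n p} → Pred (Vector L.Carrier n) p → ℕ → Set (c ⊔ ℓ ⊔ p)
  IsMinimumDistance C d =
    (∃[ x ] x ∈ C × ¬ Lⁿ.IsZero x × HasRank x d) ×
    (∀ x → x ∈ C → ¬ Lⁿ.IsZero x → ∀ r → HasRank x r → d ≤ r)

  record IsCode {p} (n k d : ℕ) (C : Pred (Vector L.Carrier n) p) : Set (c ⊔ ℓ ⊔ p) where
    field
      isSubspace      : Lⁿ.IsSubspace C
      dimension       : Lⁿ.HasDimension C k
      1≤k             : 1 ≤ k
      minimumDistance : IsMinimumDistance C d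

  IsGeneratorMatrix : ∀ {n k p} → Matrix L.Carrier k n → Pred (Vector L.Carrier n) p →
                      Set (c ⊔ ℓ ⊔ p)
  IsGeneratorMatrix G C = Lⁿ.Span G ≐ C

  Nondegenerate : ∀ {n p} → Pred (Vector L.Carrier n) p → Set (c ⊔ ℓ ⊔ p)
  Nondegenerate C = Fⁿ.FamilySum {I = ∃ C} (λ (x , _) → σ x) ≐ U

  RankIntersecting : ∀ {n p} → Pred (Vector L.Carrier n) p → Set (c ⊔ ℓ ⊔ p)
  RankIntersecting C = ∀ x y → x ∈ C → y ∈ C → ¬ Lⁿ.IsZero x → ¬ Lⁿ.IsZero y →
                       ¬ ((σ x ∩ σ y) ≐ Fⁿ.IsZero)

  HammingIntersecting : ∀ {n p} → Pred (Vector L.Carrier n) p → Set (c ⊔ ℓ ⊔ p)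
  HammingIntersecting C = ∀ x y → x ∈ C → y ∈ C → ¬ Lⁿ.IsZero x → ¬ Lⁿ.IsZero y →
                          ∃[ i ] x i L.≉ L.0# × y i L.≉ L.0#

  infixl 7 _·_
  _·_ : ∀ {r n} → Matrix L.Carrier r n → GL F n → Matrix L.Carrier r n
  M · A = _⊗_ L M (λ i j → ι (GL.matrix A i j))

  -- { xA : x ∈ C }, with x regarded as a 1 × n matrix.
  infixl 7 _·ᶜ_
  _·ᶜ_ : ∀ {n p} → Pred (Vector L.Carrier n) p → GL F n → Pred (Vector L.Carrier n) (c ⊔ ℓ ⊔ p)
  (C ·ᶜ A) y = ∃[ x ] x ∈ C × (∀ j → y j L.≈ ((λ (_ : Fin 1) → x) · A) zero j)

  TwoSpannable : ∀ {k p} → Pred (Vector L.Carrier k) p → Set (lsuc (c ⊔ ℓ) ⊔ p)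
  TwoSpannable {k} 𝒰 =
    Σ (Pred (Vector L.Carrier k) (c ⊔ ℓ)) λ H₁ → Σ (Pred (Vector L.Carrier k) (c ⊔ ℓ)) λ H₂ →
      IsHyperplane L k H₁ × IsHyperplane L k H₂ ×
      𝒰 ≐ (H₁ ∩ 𝒰) LF.⊞ (H₂ ∩ 𝒰)

  system : ∀ {n k} → Matrix L.Carrier k n → Pred (Vector L.Carrier k) (c ⊔ ℓ)
  system G = LF.Span (column G)

  module _ {n k p} {C : Pred (Vector L.Carrier n) p} {G : Matrix L.Carrier k n}
           (nondegenerate : Nondegenerate C) (generates : IsGeneratorMatrix G C) where
    private
      module ΣF = SemiringSum F.semiring
      module ΣL = SemiringSum L.semiring

      sum-pointwiseL : ∀ {r s} (v : Fin r → Vector L.Carrier s) j →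
                       Lⁿ.sumᴹ v j L.≈ ΣL.sum (λ i → v i j)
      sum-pointwiseL {zero}  v j = L.refl
      sum-pointwiseL {suc r} v j = L.+-congˡ (sum-pointwiseL (v ∘ suc) j)

      sum-pointwiseF : ∀ {r s} (v : Fin r → Vector F.Carrier s) j →
                       Fⁿ.sumᴹ v j F.≈ ΣF.sum (λ i → v i j)
      sum-pointwiseF {zero}  v j = F.refl
      sum-pointwiseF {suc r} v j = F.+-congˡ (sum-pointwiseF (v ∘ suc) j)

      ι-sum : ∀ {r} (v : Vector F.Carrier r) → ι (ΣF.sum v) L.≈ ΣL.sum (ι ∘ v)
      ι-sum {zero}  v = ι.0#-homo
      ι-sum {suc r} v = L.trans (ι.+-homo _ _) (L.+-congˡ (ι-sum (v ∘ suc)))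

      zero-sumL : ∀ {r} (v : Vector L.Carrier r) → (∀ i → v i L.≈ L.0#) → ΣL.sum v L.≈ L.0#
      zero-sumL {r} v p = L.trans (ΣL.sum-cong-≋ p) (ΣL.sum-replicate-zero r)

      zero-sumF : ∀ {r} (v : Vector F.Carrier r) → (∀ i → v i F.≈ F.0#) → ΣF.sum v F.≈ F.0#
      zero-sumF {r} v p = F.trans (ΣF.sum-cong-≋ p) (ΣF.sum-replicate-zero r)

      -- a is a vector of F^n orthogonal to every row of G.
      module _ (a : Vector F.Carrier n)
               (G⊥a : ∀ i → ΣL.sum (λ l → G i l L.* ι (a l)) L.≈ L.0#) where

        C⊥a : ∀ x → x ∈ C → ΣL.sum (λ l → x l L.* ι (a l)) L.≈ L.0#
        C⊥a x x∈C with proj₂ generates x∈C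
        ... | u , x≈uG = begin
          ΣL.sum (λ l → x l L.* ι (a l))
            ≈⟨ ΣL.sum-cong-≋ (λ l → L.*-congʳ
                 (L.trans (x≈uG l) (sum-pointwiseL (λ i l → u i L.* G i l) l))) ⟩
          ΣL.sum (λ l → ΣL.sum (λ i → u i L.* G i l) L.* ι (a l))
            ≈⟨ ΣL.sum-cong-≋ (λ l → ΣL.*-distribʳ-sum (ι (a l)) (λ i → u i L.* G i l)) ⟩
          ΣL.sum (λ l → ΣL.sum (λ i → u i L.* G i l L.* ι (a l)))
            ≈⟨ ΣL.∑-comm (λ l i → u i L.* G i l L.* ι (a l)) ⟩
          ΣL.sum (λ i → ΣL.sum (λ l → u i L.* G i l L.* ι (a l)))
            ≈⟨ zero-sumL _ (λ i → L.trans
                 (ΣL.sum-cong-≋ (λ l → L.*-assoc (u i) (G i l) (ι (a l))))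
                 (L.trans (L.sym (ΣL.*-distribˡ-sum (u i) (λ l → G i l L.* ι (a l))))
                 (L.trans (L.*-congˡ (G⊥a i)) (L.zeroʳ (u i))))) ⟩
          L.0# ∎
          where open SetoidReasoning L.setoid

        Mat⊥a : ∀ x → x ∈ C → ∀ i → ΣF.sum (λ l → Mat x i l F.* a l) F.≈ F.0#
        Mat⊥a x x∈C = proj₁ (proj₂ Γ) (λ i → ΣF.sum (λ l → Mat x i l F.* a l)) (begin
          ΣL.sum (λ i → ι (ΣF.sum (λ l → Mat x i l F.* a l)) L.* γ i)
            ≈⟨ ΣL.sum-cong-≋ (λ i → L.trans
                 (L.*-congʳ (ι-sum (λ l → Mat x i l F.* a l)))
                 (ΣL.*-distribʳ-sum (γ i) (λ l → ι (Mat x i l F.* a l)))) ⟩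
          ΣL.sum (λ i → ΣL.sum (λ l → ι (Mat x i l F.* a l) L.* γ i))
            ≈⟨ ΣL.∑-comm (λ i l → ι (Mat x i l F.* a l) L.* γ i) ⟩
          ΣL.sum (λ l → ΣL.sum (λ i → ι (Mat x i l F.* a l) L.* γ i))
            ≈⟨ ΣL.sum-cong-≋ (λ l → ΣL.sum-cong-≋ (λ i → swap (Mat x i l) (a l) (γ i))) ⟩
          ΣL.sum (λ l → ΣL.sum (λ i → ι (Mat x i l) L.* γ i L.* ι (a l)))
            ≈⟨ ΣL.sum-cong-≋ (λ l → L.trans
                 (L.sym (ΣL.*-distribʳ-sum (ι (a l)) (λ i → ι (Mat x i l) L.* γ i)))
                 (L.*-congʳ (L.sym (proj₂ (proj₂ (proj₂ (proj₂ Γ)) {x l} _))))) ⟩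
          ΣL.sum (λ l → x l L.* ι (a l))
            ≈⟨ C⊥a x x∈C ⟩
          L.0# ∎)
          where
          open SetoidReasoning L.setoid
          γ = proj₁ Γ
          swap : ∀ b b′ g → ι (b F.* b′) L.* g L.≈ ι b L.* g L.* ι b′
          swap b b′ g = L.trans (L.*-congʳ (ι.*-homo b b′))
            (L.trans (L.*-assoc (ι b) (ι b′) g)
            (L.trans (L.*-congˡ (L.*-comm (ι b′) g)) (L.sym (L.*-assoc (ι b) g (ι b′)))))

        sum⊥a : ∀ {r} (v : Fin r → Vector F.Carrier n) →
                (∀ t → ΣF.sum (λ l → v t l F.* a l) F.≈ F.0#) →
                (w : Vector F.Carrier n) → (∀ l → w l F.≈ Fⁿ.sumᴹ v l) → ΣF.sum (λ l → w l F.* a l) F.≈ F.0#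
        sum⊥a v v⊥a w w≈Σv = begin
          ΣF.sum (λ l → w l F.* a l)
            ≈⟨ ΣF.sum-cong-≋ (λ l → F.*-congʳ (F.trans (w≈Σv l) (sum-pointwiseF v l))) ⟩
          ΣF.sum (λ l → ΣF.sum (λ t → v t l) F.* a l)
            ≈⟨ ΣF.sum-cong-≋ (λ l → ΣF.*-distribʳ-sum (a l) (λ t → v t l)) ⟩
          ΣF.sum (λ l → ΣF.sum (λ t → v t l F.* a l))
            ≈⟨ ΣF.∑-comm (λ l t → v t l F.* a l) ⟩
          ΣF.sum (λ t → ΣF.sum (λ l → v t l F.* a l))
            ≈⟨ zero-sumF _ v⊥a ⟩
          F.0# ∎
          where open SetoidReasoning F.setoid

        all⊥a : ∀ w → ΣF.sum (λ l → w l F.* a l) F.≈ F.0#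
        all⊥a w with proj₂ nondegenerate {w} _
        ... | _ , xs , v , v∈σ , w≈Σv = sum⊥a v v⊥a w w≈Σv
          where
          v⊥a : ∀ t → ΣF.sum (λ l → v t l F.* a l) F.≈ F.0#
          v⊥a t with v∈σ t
          ... | b , vₜ≈ = sum⊥a (λ i l → b i F.* Mat x i l) rows⊥a (v t) vₜ≈
            where
            x = proj₁ (xs t)
            rows⊥a : ∀ i → ΣF.sum (λ l → b i F.* Mat x i l F.* a l) F.≈ F.0#
            rows⊥a i = F.trans
              (ΣF.sum-cong-≋ (λ l → F.*-assoc (b i) (Mat x i l) (a l)))
              (F.trans (F.sym (ΣF.*-distribˡ-sum (b i) (λ l → Mat x i l F.* a l)))
              (F.trans (F.*-congˡ (Mat⊥a x (proj₂ (xs t)) i)) (F.zeroʳ (b i))))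

    column-nonzero : (A : GL F n) → ∀ j → ¬ Lⁿ.IsZero (column (G · A) j)
    column-nonzero A j col≈0 = IsField.1≉0 F-isField
      (F.trans (F.sym (F.trans (GL.inverseˡ A j j) diagonal))
               (all⊥a (column (GL.matrix A) j) col≈0 (GL.matrix⁻¹ A j)))
      where
      diagonal : identityMatrix F n j j F.≈ F.1#
      diagonal with j Fin.≟ j
      ... | yes _   = F.refl
      ... | no  j≢j = contradiction ≡.refl j≢j

    columnPoints : GL F n → Vector (Setoid.Carrier (PG L L-isField k)) n
    columnPoints A j = column (G · A) j , column-nonzero A j

{-# OPTIONS --safe #-}

-- Write x ⊥ a if Σ x_l a_l = 0, for x ∈ L^n and a ∈ F^n; then x^⊥ is the orthogonal of σ(x).
-- For nonzero codewords x and y the following are equivalent: σ(x) ∩ σ(y) = 0;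
-- F^n = x^⊥ + y^⊥; some A ∈ GL(n, q) has all its columns in x^⊥ ∪ y^⊥.  The first two by duality,
-- the last two by exchanging the columns of the identity matrix for vectors of x^⊥ ∪ y^⊥.
-- Each of the four statements says that no such x and y exist: the hyperplanes of L^k are
-- the kernels of the nonzero functionals u, which correspond to the nonzero codewords u G,
-- and the pairing of u with G a is that of u G with a.
module Submission where

open import Level using (Lift; lift; _⊔_)
open import Algebra.Bundles using (CommutativeRing)
import Algebra.Properties.AbelianGroup as AbelianGroupProperties
import Algebra.Properties.Ring as RingProperties
import Algebra.Properties.CommutativeSemigroup as CommutativeSemigroupProperties
import Algebra.Properties.Semiring.Sum as SemiringSum
open import Data.Fin.Base using (Fin; zero; suc; punchIn; punchOut; _↑ˡ_; _↑ʳ_)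
import Data.Fin.Properties as Fin
open import Data.List.Base using (List; []; _∷_; allFin)
open import Data.List.Membership.Propositional using () renaming (_∈_ to _∈ᴸ_)
open import Data.List.Membership.Propositional.Properties using (∈-allFin)
open import Data.List.Relation.Unary.Any using (here; there)
open import Data.Nat.Base using (ℕ; zero; suc; _≤_; s≤s) renaming (_+_ to _+ℕ_)
open import Data.Product.Base using (∃; ∃₂; _×_; _,_; proj₁; proj₂)
open import Data.Sum.Base as Sum using (_⊎_; inj₁; inj₂; [_,_])
open import Data.Vec.Functional using (Vector; insertAt; removeAt; updateAt; _++_)
  renaming (_∷_ to _∷ᵥ_)
open import Data.Vec.Functional.Properties
  using (insertAt-lookup; insertAt-punchIn; updateAt-updates; updateAt-minimal;
         lookup-++ˡ; lookup-++ʳ)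
open import Function.Base using (_∘_; const)
open import Function.Bundles using (_⇔_; mk⇔)
open import Function.Construct.Composition using (_⇔-∘_)
open import Function.Construct.Symmetry using (⇔-sym)
open import Function.Properties.Inverse using (Inverse⇒Injection)
open import Relation.Binary.Definitions using (Decidable)
open import Relation.Binary.PropositionalEquality.Core as ≡ using (_≡_; _≢_)
import Relation.Binary.Reasoning.Setoid as SetoidReasoning
open import Relation.Nullary.Decidable.Core using (Dec; yes; no; ¬?; _×-dec_)
open import Relation.Nullary.Negation.Core using (¬_; contradiction)
open import Relation.Unary using (Pred; _∈_; _∩_; _≐_)
open import Defs

-- Dot products and products of vectors with matrices over a commutative ring.

module DotProduct {c ℓ} (K : CommutativeRing c ℓ) where
  open CommutativeRing K hiding (zero)
  open SemiringSum semiring public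
    using (sum; sum-cong-≋; sum-replicate-zero; sum-remove; ∑-distrib-+; ∑-comm;
           *-distribˡ-sum; *-distribʳ-sum)
  open RingProperties ring using (-1*x≈-x)
  open CommutativeSemigroupProperties *-commutativeSemigroup using (x∙yz≈y∙xz)
  open LinearAlgebra using (sumᴹ; lincomb)
  open SetoidReasoning setoid

  infix 8 _∙_
  _∙_ : ∀ {n} → Vector Carrier n → Vector Carrier n → Carrier
  x ∙ y = sum (λ l → x l * y l)

  infixl 9 _⊙_
  _⊙_ : ∀ {r n} → Vector Carrier r → Matrix Carrier r n → Vector Carrier n
  (a ⊙ M) j = a ∙ column M j

  ∙-cong : ∀ {n} {x x′ y y′ : Vector Carrier n} →
           (∀ i → x i ≈ x′ i) → (∀ i → y i ≈ y′ i) → x ∙ y ≈ x′ ∙ y′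
  ∙-cong x≈x′ y≈y′ = sum-cong-≋ (λ l → *-cong (x≈x′ l) (y≈y′ l))

  ∙-congˡ : ∀ {n} {x y y′ : Vector Carrier n} → (∀ i → y i ≈ y′ i) → x ∙ y ≈ x ∙ y′
  ∙-congˡ = ∙-cong (λ _ → refl)

  ∙-congʳ : ∀ {n} {x x′ y : Vector Carrier n} → (∀ i → x i ≈ x′ i) → x ∙ y ≈ x′ ∙ y
  ∙-congʳ x≈x′ = ∙-cong x≈x′ (λ _ → refl)

  ∙-comm : ∀ {n} (x y : Vector Carrier n) → x ∙ y ≈ y ∙ x
  ∙-comm x y = sum-cong-≋ (λ l → *-comm (x l) (y l))

  ∙-zero : ∀ {n} {x y : Vector Carrier n} → (∀ i → x i ≈ 0# ⊎ y i ≈ 0#) → x ∙ y ≈ 0#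
  ∙-zero {n} {x} {y} xy≈0 = trans (sum-cong-≋ termwise) (sum-replicate-zero n)
    where
    termwise : ∀ i → x i * y i ≈ 0#
    termwise i with xy≈0 i
    ... | inj₁ xᵢ≈0 = trans (*-congʳ xᵢ≈0) (zeroˡ (y i))
    ... | inj₂ yᵢ≈0 = trans (*-congˡ yᵢ≈0) (zeroʳ (x i))

  ∙-zeroˡ : ∀ {n} {x : Vector Carrier n} y → (∀ i → x i ≈ 0#) → x ∙ y ≈ 0#
  ∙-zeroˡ _ x≈0 = ∙-zero (inj₁ ∘ x≈0)

  ∙-zeroʳ : ∀ {n} x {y : Vector Carrier n} → (∀ i → y i ≈ 0#) → x ∙ y ≈ 0#
  ∙-zeroʳ _ y≈0 = ∙-zero (inj₂ ∘ y≈0)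

  ∙-+ʳ : ∀ {n} (x y z : Vector Carrier n) → x ∙ (λ i → y i + z i) ≈ x ∙ y + x ∙ z
  ∙-+ʳ x y z = trans (sum-cong-≋ (λ l → distribˡ (x l) (y l) (z l)))
                     (∑-distrib-+ (λ l → x l * y l) (λ l → x l * z l))

  ∙-*ʳ : ∀ {n} (x : Vector Carrier n) a y → x ∙ (λ i → a * y i) ≈ a * x ∙ y
  ∙-*ʳ x a y = trans (sum-cong-≋ (λ l → x∙yz≈y∙xz (x l) a (y l)))
                     (sym (*-distribˡ-sum a (λ l → x l * y l)))

  ∙-*ˡ : ∀ {n} a (x y : Vector Carrier n) → (λ i → a * x i) ∙ y ≈ a * x ∙ y
  ∙-*ˡ a x y = trans (∙-comm _ y) (trans (∙-*ʳ y a x) (*-congˡ (∙-comm y x)))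

  ∙-+*ʳ : ∀ {n} (x y : Vector Carrier n) a z → x ∙ (λ i → y i + a * z i) ≈ x ∙ y + a * x ∙ z
  ∙-+*ʳ x y a z = trans (∙-+ʳ x y (λ i → a * z i)) (+-congˡ (∙-*ʳ x a z))

  ∙-+*ˡ : ∀ {n} (x : Vector Carrier n) a y z → (λ i → x i + a * y i) ∙ z ≈ x ∙ z + a * y ∙ z
  ∙-+*ˡ x a y z = trans (∙-comm _ z)
    (trans (∙-+*ʳ z x a y) (+-cong (∙-comm z x) (*-congˡ (∙-comm z y))))

  ∙-negˡ : ∀ {n} (x y : Vector Carrier n) → (λ i → - x i) ∙ y ≈ - (x ∙ y)
  ∙-negˡ x y = begin
    (λ i → - x i) ∙ y         ≈⟨ ∙-congʳ (λ i → -1*x≈-x (x i)) ⟨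
    (λ i → - 1# * x i) ∙ y    ≈⟨ ∙-*ˡ (- 1#) x y ⟩
    - 1# * x ∙ y              ≈⟨ -1*x≈-x (x ∙ y) ⟩
    - (x ∙ y)                 ∎

  ∙-negʳ : ∀ {n} (x y : Vector Carrier n) → x ∙ (λ i → - y i) ≈ - (x ∙ y)
  ∙-negʳ x y = trans (∙-comm x _) (trans (∙-negˡ y x) (-‿cong (∙-comm y x)))

  ∙-remove : ∀ {n} i (x y : Vector Carrier (suc n)) →
             x ∙ y ≈ x i * y i + removeAt x i ∙ removeAt y i
  ∙-remove i x y = sum-remove {i = i} (λ l → x l * y l)

  ∙-split : ∀ m {n} (x y : Vector Carrier (m +ℕ n)) →
            x ∙ y ≈ (x ∘ (_↑ˡ n)) ∙ (y ∘ (_↑ˡ n)) + (x ∘ (m ↑ʳ_)) ∙ (y ∘ (m ↑ʳ_))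
  ∙-split zero    x y = sym (+-identityˡ _)
  ∙-split (suc m) x y = trans (+-congˡ (∙-split m (x ∘ suc) (y ∘ suc))) (sym (+-assoc _ _ _))

  -- Interchange of the two finite sums. Passages between the pairing of a combined vector and the
  -- pairing of its coefficients rest on this identity.
  ⊙-∙-assoc : ∀ {r n} (a : Vector Carrier r) (M : Matrix Carrier r n) y →
              (a ⊙ M) ∙ y ≈ a ∙ (λ i → M i ∙ y)
  ⊙-∙-assoc a M y = begin
    sum (λ l → sum (λ i → a i * M i l) * y l)
      ≈⟨ sum-cong-≋ (λ l → *-distribʳ-sum (y l) (λ i → a i * M i l)) ⟩
    sum (λ l → sum (λ i → a i * M i l * y l))
      ≈⟨ ∑-comm (λ l i → a i * M i l * y l) ⟩
    sum (λ i → sum (λ l → a i * M i l * y l))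
      ≈⟨ sum-cong-≋ (λ i → sum-cong-≋ (λ l → *-assoc (a i) (M i l) (y l))) ⟩
    sum (λ i → sum (λ l → a i * (M i l * y l)))
      ≈⟨ sum-cong-≋ (λ i → *-distribˡ-sum (a i) (λ l → M i l * y l)) ⟨
    sum (λ i → a i * M i ∙ y) ∎

  identityMatrix-diagonal : ∀ {n} (i : Fin n) → identityMatrix K n i i ≡ 1#
  identityMatrix-diagonal i with i Fin.≟ i
  ... | yes _   = ≡.refl
  ... | no  i≢i = contradiction ≡.refl i≢i

  identityMatrix-offDiagonal : ∀ {n} {i j : Fin n} → i ≢ j → identityMatrix K n i j ≡ 0#
  identityMatrix-offDiagonal {i = i} {j} i≢j with i Fin.≟ j
  ... | yes i≡j = contradiction i≡j i≢j
  ... | no  _   = ≡.refl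

  ∙-identityˡ : ∀ {n} i (y : Vector Carrier n) → identityMatrix K n i ∙ y ≈ y i
  ∙-identityˡ zero y =
    trans (+-cong (*-identityˡ _) (∙-zeroˡ (y ∘ suc) (λ _ → refl))) (+-identityʳ _)
  ∙-identityˡ (suc i) y = trans (+-cong (zeroˡ _) (∙-identityˡ i (y ∘ suc))) (+-identityˡ _)

  ⊙-identityʳ : ∀ {n} (x : Vector Carrier n) j → (x ⊙ identityMatrix K n) j ≈ x j
  ⊙-identityʳ x zero =
    trans (+-cong (*-identityʳ _) (∙-zeroʳ (x ∘ suc) (λ _ → refl))) (+-identityʳ _)
  ⊙-identityʳ x (suc j) = trans (+-cong (zeroʳ _) (⊙-identityʳ (x ∘ suc) j)) (+-identityˡ _)

  sumᴹ-pointwise : ∀ {s n} (v : Matrix Carrier s n) j →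
                   sumᴹ (coordinateSpace K n) v j ≈ sum (column v j)
  sumᴹ-pointwise {zero}  v j = refl
  sumᴹ-pointwise {suc s} v j = +-congˡ (sumᴹ-pointwise (v ∘ suc) j)

  -- Spans and independence are stated with `lincomb`, which adds whole vectors; the proof computes
  -- with entrywise dot products. This is the bridge.
  lincomb≈⊙ : ∀ {s n} a (v : Matrix Carrier s n) j →
              lincomb (coordinateSpace K n) a v j ≈ (a ⊙ v) j
  lincomb≈⊙ a v = sumᴹ-pointwise (λ i l → a i * v i l)

  Span⊆orthogonal : ∀ {s n} {u : Vector Carrier n} {h : Matrix Carrier s n} →
                    (∀ i → u ∙ h i ≈ 0#) →
                    ∀ v → LinearAlgebra.Span (coordinateSpace K n) h v → u ∙ v ≈ 0#
  Span⊆orthogonal {u = u} {h} u∙h≈0 v (a , v≈ah) = begin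
    u ∙ v                 ≈⟨ ∙-congˡ (λ l → trans (v≈ah l) (lincomb≈⊙ a h l)) ⟩
    u ∙ (a ⊙ h)           ≈⟨ ∙-comm u (a ⊙ h) ⟩
    (a ⊙ h) ∙ u           ≈⟨ ⊙-∙-assoc a h u ⟩
    a ∙ (λ i → h i ∙ u)   ≈⟨ ∙-zeroʳ a (λ i → trans (∙-comm (h i) u) (u∙h≈0 i)) ⟩
    0#                    ∎

-- Linear algebra over a field with decidable equality.

module FieldLinearAlgebra {c ℓ} (K : CommutativeRing c ℓ) (isField : IsField K)
  (_≟_ : Decidable (CommutativeRing._≈_ K)) where
  open CommutativeRing K hiding (zero)
  open IsField isField
  open DotProduct K
  open RingProperties ring
    using (-‿distribˡ-*; -‿distribʳ-*; +-inverseʳ-unique; +-cancelʳ; -‿+-comm; -‿involutive)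
  open CommutativeSemigroupProperties *-commutativeSemigroup using (xy∙z≈xz∙y)
  open SetoidReasoning setoid

  IsZero : ∀ {n} → Pred (Vector Carrier n) ℓ
  IsZero x = ∀ i → x i ≈ 0#

  *-cancelˡ : ∀ {a} → a ≉ 0# → ∀ {x y} → a * x ≈ a * y → x ≈ y
  *-cancelˡ {a} a≉0 {x} {y} ax≈ay with b , ab≈1 ← inverse a a≉0 = begin
    x            ≈⟨ b*[ax] x ⟨
    b * (a * x)  ≈⟨ *-congˡ ax≈ay ⟩
    b * (a * y)  ≈⟨ b*[ax] y ⟩
    y            ∎
    where
    b*[ax] : ∀ x → b * (a * x) ≈ x
    b*[ax] x = trans (sym (*-assoc b a x))
                     (trans (*-congʳ (trans (*-comm b a) ab≈1)) (*-identityˡ x))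

  x+[-a]*0 : ∀ {x y} a → y ≈ 0# → x + - a * y ≈ x
  x+[-a]*0 a y≈0 = trans (+-congˡ (trans (*-congˡ y≈0) (zeroʳ (- a)))) (+-identityʳ _)

  x-ab≈0 : ∀ {x a b} → a * b ≈ x → x + - a * b ≈ 0#
  x-ab≈0 {x} {a} {b} ab≈x =
    trans (+-congˡ (trans (sym (-‿distribˡ-* a b)) (-‿cong ab≈x))) (-‿inverseʳ x)

  isZero? : ∀ {n} (x : Vector Carrier n) → Dec (IsZero x)
  isZero? x = Fin.all? (λ i → x i ≟ 0#)

  nonzeroEntry : ∀ {n} (x : Vector Carrier n) → ¬ IsZero x → ∃ λ i → x i ≉ 0#
  nonzeroEntry {n} x = Fin.¬∀⟶∃¬ n _ (λ i → x i ≟ 0#)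

  -- The Fredholm alternative, by induction on the number of vectors. A `z` separating `w` from the
  -- later vectors also serves for `v zero`, unless `v zero ∙ z` is nonzero; in that case `w` is
  -- corrected by a multiple of `v zero` and the induction hypothesis is used a second time.
  span-or-separate : ∀ {s n} (v : Matrix Carrier s n) (w : Vector Carrier n) →
    (∃ λ a → ∀ l → w l ≈ (a ⊙ v) l) ⊎ (∃ λ z → (∀ i → v i ∙ z ≈ 0#) × w ∙ z ≉ 0#)
  span-or-separate {zero} {n} v w with isZero? w
  ... | yes w≈0 = inj₁ ((λ ()) , w≈0)
  ... | no  w≉0 with i , wᵢ≉0 ← nonzeroEntry w w≉0 =
    inj₂ (column (identityMatrix K n) i , (λ ()) ,
          λ w∙eᵢ≈0 → wᵢ≉0 (trans (sym (⊙-identityʳ w i)) w∙eᵢ≈0))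
  span-or-separate {suc s} v w with span-or-separate (v ∘ suc) w
  ... | inj₁ (a , w≈) =
    inj₁ (0# ∷ᵥ a , λ l → trans (w≈ l) (sym (trans (+-congʳ (zeroˡ _)) (+-identityˡ _))))
  ... | inj₂ (z , v∙z≈0 , w∙z≉0) with (v zero ∙ z) ≟ 0#
  ... | yes v₀∙z≈0 = inj₂ (z , (λ { zero → v₀∙z≈0 ; (suc i) → v∙z≈0 i }) , w∙z≉0)
  ... | no  v₀∙z≉0 with d , v₀zd≈1 ← inverse (v zero ∙ z) v₀∙z≉0
      -- The coefficient `w ∙ z` divided by `v zero ∙ z` makes the corrected vector orthogonal to
      -- `z`.
      with span-or-separate (v ∘ suc) (λ l → w l + - (d * w ∙ z) * v zero l)
  ... | inj₁ (a , w′≈) = inj₁ (d * w ∙ z ∷ᵥ a , λ l → begin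
        w l                                     ≈⟨ +-identityˡ (w l) ⟨
        0# + w l                                ≈⟨ +-congʳ (-‿inverseʳ (t * v zero l)) ⟨
        t * v zero l + - (t * v zero l) + w l   ≈⟨ +-assoc _ _ _ ⟩
        t * v zero l + (- (t * v zero l) + w l) ≈⟨ +-congˡ (+-comm _ _) ⟩
        t * v zero l + (w l + - (t * v zero l)) ≈⟨ +-congˡ (+-congˡ (-‿distribˡ-* t (v zero l))) ⟩
        t * v zero l + (w l + - t * v zero l)   ≈⟨ +-congˡ (w′≈ l) ⟩
        t * v zero l + (a ⊙ (v ∘ suc)) l        ∎)
    where t = d * w ∙ z
  ... | inj₂ (z′ , v∙z′≈0 , w′∙z′≉0) = inj₂ (z″ , v∙z″≈0 , λ w∙z″≈0 → w′∙z′≉0 (begin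
        (λ l → w l + - (d * w ∙ z) * v zero l) ∙ z′  ≈⟨ ∙-+*ˡ w (- (d * w ∙ z)) (v zero) z′ ⟩
        w ∙ z′ + - (d * w ∙ z) * v zero ∙ z′         ≈⟨ +-congˡ (-‿distribˡ-* _ _) ⟨
        w ∙ z′ + - (d * w ∙ z * v zero ∙ z′)         ≈⟨ +-congˡ (-‿cong (xy∙z≈xz∙y d (w ∙ z) (v zero ∙ z′))) ⟩
        w ∙ z′ + - (t * w ∙ z)                       ≈⟨ +-congˡ (-‿distribˡ-* _ _) ⟩
        w ∙ z′ + - t * w ∙ z                         ≈⟨ ∙-+*ʳ w z′ (- t) z ⟨
        w ∙ z″                                       ≈⟨ w∙z″≈0 ⟩
        0#                                           ∎))
    where
    t = d * v zero ∙ z′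
    -- Subtracting `t` times `z` cancels the pairing of `z′` with `v zero` and keeps those with the
    -- later vectors zero. The pairing of `w` with `z″` is that of the corrected vector with `z′`.
    z″ : Vector Carrier _
    z″ l = z′ l + - t * z l
    v∙z″≈0 : ∀ i → v i ∙ z″ ≈ 0#
    v∙z″≈0 zero = trans (∙-+*ʳ (v zero) z′ (- t) z) (x-ab≈0 (begin
      d * v zero ∙ z′ * v zero ∙ z    ≈⟨ xy∙z≈xz∙y d (v zero ∙ z′) (v zero ∙ z) ⟩
      d * v zero ∙ z * v zero ∙ z′    ≈⟨ *-congʳ (trans (*-comm _ _) v₀zd≈1) ⟩
      1# * v zero ∙ z′                ≈⟨ *-identityˡ _ ⟩
      v zero ∙ z′                     ∎))
    v∙z″≈0 (suc i) = trans (∙-+*ʳ (v (suc i)) z′ (- t) z)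
                           (trans (x+[-a]*0 t (v∙z≈0 i)) (v∙z′≈0 i))

  -- Homogeneous linear systems by elimination.

  quotients : ∀ {n} (c : Vector Carrier n) {i} → c i ≉ 0# → ∃ λ q → ∀ j → c j ≈ q j * c i
  quotients c {i} cᵢ≉0 with d , cᵢd≈1 ← inverse (c i) cᵢ≉0 =
    (λ j → c j * d) , λ j → sym (trans (*-assoc (c j) d (c i))
      (trans (*-congˡ (trans (*-comm d (c i)) cᵢd≈1)) (*-identityʳ (c j))))

  -- The conclusion is weaker than `c i ≉ 0#` so that it also covers `c = 0`, with `q = 0` and an
  -- arbitrary `i`. It is all that makes `kernelBasis i q` orthogonal to `c`, hence elimination
  -- needs no case distinction.
  pivot : ∀ {s} (c : Vector Carrier (suc s)) → ∃₂ λ i q → ∀ j → c j ≈ q j * c i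
  pivot c with isZero? c
  ... | yes c≈0 = zero , (λ _ → 0#) , λ j → trans (c≈0 j) (sym (zeroˡ _))
  ... | no  c≉0 with i , cᵢ≉0 ← nonzeroEntry c c≉0 = i , quotients c cᵢ≉0

  -- The basis of the hyperplane { x : x_i = - Σ_{j ≠ i} q_j x_j }, in which the
  -- coordinates of x are the x_j with j ≠ i.
  kernelBasis : ∀ {s} → Fin (suc s) → Vector Carrier (suc s) → Matrix Carrier s (suc s)
  kernelBasis {s} i q j = insertAt (identityMatrix K s j) i (- q (punchIn i j))

  module _ {s} {c q : Vector Carrier (suc s)} {i} (c≈q : ∀ j → c j ≈ q j * c i) where
    kernelBasis-∙ : ∀ j → kernelBasis i q j ∙ c ≈ 0#
    kernelBasis-∙ j = begin
      kernelBasis i q j ∙ c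
        ≈⟨ ∙-remove i (kernelBasis i q j) c ⟩
      kernelBasis i q j i * c i + removeAt (kernelBasis i q j) i ∙ removeAt c i
        ≈⟨ +-cong (*-congʳ (reflexive (insertAt-lookup (identityMatrix K s j) i _)))
                  (∙-congʳ (λ l → reflexive (insertAt-punchIn (identityMatrix K s j) i _ l))) ⟩
      - q (punchIn i j) * c i + identityMatrix K s j ∙ removeAt c i
        ≈⟨ +-congˡ (∙-identityˡ j (removeAt c i)) ⟩
      - q (punchIn i j) * c i + c (punchIn i j)
        ≈⟨ +-comm _ _ ⟩
      c (punchIn i j) + - q (punchIn i j) * c i
        ≈⟨ x-ab≈0 (sym (c≈q (punchIn i j))) ⟩
      0# ∎

    ⊙-kernelBasis-∙ : ∀ a → (a ⊙ kernelBasis i q) ∙ c ≈ 0#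
    ⊙-kernelBasis-∙ a = trans (⊙-∙-assoc a (kernelBasis i q) c) (∙-zeroʳ a kernelBasis-∙)

  ⊙-kernelBasis-punchIn : ∀ {s} i q (a : Vector Carrier s) l →
                          (a ⊙ kernelBasis i q) (punchIn i l) ≈ a l
  ⊙-kernelBasis-punchIn {s} i q a l = trans
    (∙-congˡ (λ j → reflexive (insertAt-punchIn (identityMatrix K s j) i _ l)))
    (⊙-identityʳ a l)

  -- The first equation is eliminated by writing `u` as a combination of `kernelBasis`, which leaves
  -- one equation and one unknown fewer. The combination is nonzero because its entries off the
  -- pivot are its coefficients.
  ∃-orthogonal : ∀ {s} (M : Matrix Carrier s (suc s)) →
                 ∃ λ u → ¬ IsZero u × (∀ i → u ∙ M i ≈ 0#)
  ∃-orthogonal {zero}  M = (λ _ → 1#) , (λ 1≈0 → 1≉0 (1≈0 zero)) , λ ()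
  ∃-orthogonal {suc s} M with i , q , M₀≈q ← pivot (M zero)
    with v , v≉0 , v∙≈0 ← ∃-orthogonal (λ r j → kernelBasis i q j ∙ M (suc r)) =
    v ⊙ kernelBasis i q ,
    (λ u≈0 → v≉0 (λ l → trans (sym (⊙-kernelBasis-punchIn i q v l)) (u≈0 (punchIn i l)))) ,
    λ { zero    → ⊙-kernelBasis-∙ M₀≈q v
      ; (suc r) → trans (⊙-∙-assoc v (kernelBasis i q) (M (suc r))) (v∙≈0 r) }

  -- Square matrices: injectivity, surjectivity and one-sided inverses.

  module _ {n} (T : Matrix Carrier n n) (injective : ∀ v → IsZero (v ⊙ T) → IsZero v) where
    -- The `suc n` vectors consisting of `w` and the rows of `T` are linearly dependent. The
    -- coefficient of `w` in a dependence is nonzero, for otherwise injectivity would make the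
    -- dependence trivial; so it can be solved for `w`.
    injective⇒surjective : (w : Vector Carrier n) → ∃ λ v → ∀ j → (v ⊙ T) j ≈ w j
    injective⇒surjective w with u , u≉0 , u∙≈0 ← ∃-orthogonal (λ j → w j ∷ᵥ column T j)
      with u zero ≟ 0#
    ... | yes u₀≈0 = contradiction
      (λ { zero → u₀≈0
         ; (suc i) → injective (u ∘ suc)
             (λ j → trans (sym (trans (+-congʳ (trans (*-congʳ u₀≈0) (zeroˡ _))) (+-identityˡ _)))
                          (u∙≈0 j)) i })
      u≉0
    ... | no  u₀≉0 with d , u₀d≈1 ← inverse (u zero) u₀≉0 = (λ i → - d * u (suc i)) , λ j → begin
        (λ i → - d * u (suc i)) ∙ column T j
          ≈⟨ ∙-*ˡ (- d) (u ∘ suc) (column T j) ⟩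
        - d * (u ∘ suc) ∙ column T j
          ≈⟨ *-congˡ (+-inverseʳ-unique _ _ (u∙≈0 j)) ⟩
        - d * - (u zero * w j)
          ≈⟨ -‿distribʳ-* (- d) _ ⟨
        - (- d * (u zero * w j))
          ≈⟨ -‿cong (-‿distribˡ-* d _) ⟨
        - - (d * (u zero * w j))
          ≈⟨ -‿involutive _ ⟩
        d * (u zero * w j)
          ≈⟨ *-assoc _ _ _ ⟨
        d * u zero * w j
          ≈⟨ *-congʳ (trans (*-comm _ _) u₀d≈1) ⟩
        1# * w j
          ≈⟨ *-identityˡ (w j) ⟩
        w j ∎

  module _ {n} {A B : Matrix Carrier n n}
           (AB≈I : ∀ i j → _⊗_ K A B i j ≈ identityMatrix K n i j) where
    ⊙-rightInverse : ∀ v j → ((v ⊙ A) ⊙ B) j ≈ v j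
    ⊙-rightInverse v j = trans (⊙-∙-assoc v A (column B j))
      (trans (∙-congˡ (λ i → AB≈I i j)) (⊙-identityʳ v j))

    -- From `v A B = v`, the map `v ↦ v A` is injective, hence surjective. Writing the unit vector
    -- `eᵢ` as `v A` gives `eᵢ B A = v A B A = v A = eᵢ`.
    rightInverse⇒leftInverse : ∀ i j → _⊗_ K B A i j ≈ identityMatrix K n i j
    rightInverse⇒leftInverse i j
      with v , vA≈eᵢ ← injective⇒surjective A
             (λ v vA≈0 l → trans (sym (⊙-rightInverse v l)) (∙-zeroˡ (column B l) vA≈0))
             (identityMatrix K n i) = begin
      B i ∙ column A j  ≈⟨ ∙-congʳ (λ l → ∙-identityˡ i (column B l)) ⟨
      (identityMatrix K n i ⊙ B) ∙ column A j
                        ≈⟨ ∙-congʳ (λ l → ∙-congʳ {y = column B l} vA≈eᵢ) ⟨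
      (v ⊙ A ⊙ B) ∙ column A j
                        ≈⟨ ∙-congʳ (⊙-rightInverse v) ⟩
      v ∙ column A j    ≈⟨ vA≈eᵢ j ⟩
      identityMatrix K n i j ∎

  -- Dual bases and the exchange of columns of an invertible matrix.

  DualBases : ∀ {n} → (a b : Vector (Vector Carrier n) n) → Set ℓ
  DualBases {n} a b = ∀ i j → b i ∙ a j ≈ identityMatrix K n i j

  module _ {n} {a b : Vector (Vector Carrier n) n} (dual : DualBases a b) where
    dualBases⇒GL : GL K n
    dualBases⇒GL = record
      { matrix   = column a
      ; matrix⁻¹ = b
      ; inverseˡ = dual
      ; inverseʳ = rightInverse⇒leftInverse dual
      }

    -- Steinitz exchange: `b t ∙ v` is the coefficient of `v` at `a t`, so if it is nonzero then `v`
    -- can replace `a t`. Carrying the dual basis along keeps this coefficient available for later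
    -- exchanges.
    exchange : ∀ t v → b t ∙ v ≉ 0# → ∃ λ b′ → DualBases (updateAt a t (const v)) b′
    exchange t v bₜ∙v≉0 with d , bₜvd≈1 ← inverse (b t ∙ v) bₜ∙v≉0 = b′ , dual′
      where
      I = identityMatrix K n
      -- `e i` is the multiple of `b t` whose subtraction from `b i` makes the pairing with `v`
      -- equal to `I i t`. For `i = t` the result is `b t` divided by `b t ∙ v`.
      e : Fin n → Carrier
      e i = (b i ∙ v + - I i t) * d
      b′ : Vector (Vector Carrier n) n
      b′ i l = b i l + - e i * b t l
      b′∙v : ∀ i → b′ i ∙ v ≈ I i t
      b′∙v i = begin
        b′ i ∙ v                               ≈⟨ ∙-+*ˡ (b i) (- e i) (b t) v ⟩
        b i ∙ v + - e i * b t ∙ v              ≈⟨ +-congˡ (-‿distribˡ-* _ _) ⟨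
        b i ∙ v + - (e i * b t ∙ v)            ≈⟨ +-congˡ (-‿cong (begin
          (b i ∙ v + - I i t) * d * b t ∙ v      ≈⟨ *-assoc _ _ _ ⟩
          (b i ∙ v + - I i t) * (d * b t ∙ v)    ≈⟨ *-congˡ (trans (*-comm _ _) bₜvd≈1) ⟩
          (b i ∙ v + - I i t) * 1#               ≈⟨ *-identityʳ _ ⟩
          b i ∙ v + - I i t                      ∎)) ⟩
        b i ∙ v + - (b i ∙ v + - I i t)        ≈⟨ +-congˡ (-‿+-comm _ _) ⟨
        b i ∙ v + (- (b i ∙ v) + - - I i t)    ≈⟨ +-assoc _ _ _ ⟨
        b i ∙ v + - (b i ∙ v) + - - I i t      ≈⟨ +-cong (-‿inverseʳ _) (-‿involutive _) ⟩
        0# + I i t                             ≈⟨ +-identityˡ _ ⟩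
        I i t                                  ∎
      dual′ : DualBases (updateAt a t (const v)) b′
      dual′ i j with j Fin.≟ t
      ... | yes ≡.refl rewrite updateAt-updates t {const v} a = b′∙v i
      -- The old vector `a j` is orthogonal to `b t`, so the correction does not affect its
      -- pairings.
      ... | no  j≢t    rewrite updateAt-minimal j t {const v} a j≢t =
        trans (∙-+*ˡ (b i) (- e i) (b t) (a j)) (trans
          (x+[-a]*0 (e i) (trans (dual t j)
             (reflexive (identityMatrix-offDiagonal (j≢t ∘ ≡.sym)))))
          (dual i j))

  -- Starting from the identity matrix, the columns are exchanged one by one for vectors in Q.
  module _ {n p} (Q : Pred (Vector Carrier n) p)
           (spans : ∀ z w → z ∙ w ≉ 0# → ∃ λ v → Q v × z ∙ v ≉ 0#) where
    exchangeAll : ∀ (js : List (Fin n)) →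
                  ∃₂ λ a b → DualBases a b × (∀ j → j ∈ᴸ js → Q (a j))
    exchangeAll [] = column I , I , (λ i j → ∙-identityˡ i (column I j)) , λ _ ()
      where I = identityMatrix K n
    exchangeAll (t ∷ js) with a , b , dual , Qa ← exchangeAll js
      -- Duality gives `b t ∙ a t = 1`, so `spans` applies and returns a vector of `Q` that may
      -- replace `a t`.
      with v , Qv , bₜ∙v≉0 ← spans (b t) (a t) (λ bₜaₜ≈0 → 1≉0
             (trans (sym (trans (dual t t) (reflexive (identityMatrix-diagonal t)))) bₜaₜ≈0))
      with b′ , dual′ ← exchange dual t v bₜ∙v≉0 =
      updateAt a t (const v) , b′ , dual′ , Qa′
      where
      Qa′ : ∀ j → j ∈ᴸ t ∷ js → Q (updateAt a t (const v) j)
      Qa′ j j∈ with j Fin.≟ t | j∈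
      ... | yes ≡.refl | _          = ≡.subst Q (≡.sym (updateAt-updates t a)) Qv
      ... | no  j≢t    | here j≡t   = contradiction j≡t j≢t
      ... | no  j≢t    | there j∈js = ≡.subst Q (≡.sym (updateAt-minimal j t a j≢t)) (Qa j j∈js)

    ∃-GL-columns : ∃ λ (A : GL K n) → ∀ j → Q (column (GL.matrix A) j)
    ∃-GL-columns with a , b , dual , Qa ← exchangeAll (allFin n) =
      dualBases⇒GL dual , λ j → Qa j (∈-allFin j)

  -- Hyperplanes and kernels of functionals.

  hyperplane⇒functional : ∀ {k p} {H : Pred (Vector Carrier k) p} → 1 ≤ k → IsHyperplane K k H →
                          ∃ λ u → ¬ IsZero u × (∀ {v} → v ∈ H → u ∙ v ≈ 0#)
  -- With `k` exposed as a successor, a basis of `H` amounts to `pred k` equations in `k` unknowns,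
  -- the shape that `∃-orthogonal` requires.
  hyperplane⇒functional (s≤s _) hyperplane
    with h , _ , span≐H ← IsHyperplane.codim1 hyperplane
    with u , u≉0 , u∙h≈0 ← ∃-orthogonal h =
    u , u≉0 , λ {v} v∈H → Span⊆orthogonal {u = u} u∙h≈0 v (proj₂ span≐H v∈H)

  -- `Lift` raises the predicate to the universe level at which the hyperplanes in the statements
  -- are quantified.
  Kernel : ∀ {k} → Vector Carrier k → Pred (Vector Carrier k) (c ⊔ ℓ)
  Kernel u v = Lift c (u ∙ v ≈ 0#)

  -- `kernelBasis` at a nonzero entry of `u` is a basis of the kernel. Entries off the pivot recover
  -- the coefficients, which gives independence; they also determine a vector of the kernel, which
  -- gives spanning.
  kernel-isHyperplane : ∀ {k} → 1 ≤ k → (u : Vector Carrier k) → ¬ IsZero u →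
                        IsHyperplane K k (Kernel u)
  kernel-isHyperplane (s≤s _) u u≉0 with i , uᵢ≉0 ← nonzeroEntry u u≉0
    with q , u≈q ← quotients u uᵢ≉0 = record
    { isSubspace = record
      { respects  = λ {x} {y} x≈y (lift u∙x≈0) →
          lift (trans (∙-congˡ {x = u} (λ l → sym (x≈y l))) u∙x≈0)
      ; 0-closed  = lift (∙-zeroʳ u (λ _ → refl))
      ; +-closed  = λ {x} {y} (lift u∙x≈0) (lift u∙y≈0) →
          lift (trans (∙-+ʳ u x y) (trans (+-cong u∙x≈0 u∙y≈0) (+-identityˡ 0#)))
      ; *ₗ-closed = λ a {x} (lift u∙x≈0) →
          lift (trans (∙-*ʳ u a x) (trans (*-congˡ u∙x≈0) (zeroʳ a)))
      }
    ; codim1 = h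
      , (λ a ah≈0 l → trans (sym (⊙-kernelBasis-punchIn i q a l))
                            (trans (sym (lincomb≈⊙ a h (punchIn i l))) (ah≈0 (punchIn i l))))
      , (λ {v} v∈span → lift (Span⊆orthogonal {u = u}
          (λ j → trans (∙-comm u (h j)) (kernelBasis-∙ u≈q j)) v v∈span))
      , λ {v} (lift u∙v≈0) → removeAt v i , λ l →
          trans (v≈ah v u∙v≈0 l) (sym (lincomb≈⊙ (removeAt v i) h l))
    }
    where
    h = kernelBasis i q
    u∙ah≈0 : ∀ a → u ∙ (a ⊙ h) ≈ 0#
    u∙ah≈0 a = trans (∙-comm u (a ⊙ h)) (⊙-kernelBasis-∙ u≈q a)
    -- v and its candidate combination agree off i, and both lie in the kernel of u.
    v≈ah : ∀ v → u ∙ v ≈ 0# → ∀ l → v l ≈ (removeAt v i ⊙ h) l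
    v≈ah v u∙v≈0 l with i Fin.≟ l
    ... | no i≢l = ≡.subst (λ l → v l ≈ (removeAt v i ⊙ h) l) (Fin.punchIn-punchOut i≢l)
                     (sym (⊙-kernelBasis-punchIn i q (removeAt v i) (punchOut i≢l)))
    ... | yes ≡.refl = *-cancelˡ uᵢ≉0 (+-cancelʳ (removeAt u i ∙ removeAt v i) _ _ (begin
      u i * v i + removeAt u i ∙ removeAt v i    ≈⟨ ∙-remove i u v ⟨
      u ∙ v                                      ≈⟨ u∙v≈0 ⟩
      0#                                         ≈⟨ u∙ah≈0 (removeAt v i) ⟨
      u ∙ (removeAt v i ⊙ h)                     ≈⟨ ∙-remove i u (removeAt v i ⊙ h) ⟩
      u i * (removeAt v i ⊙ h) i + removeAt u i ∙ removeAt (removeAt v i ⊙ h) i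
        ≈⟨ +-congˡ (∙-congˡ (⊙-kernelBasis-punchIn i q (removeAt v i))) ⟩
      u i * (removeAt v i ⊙ h) i + removeAt u i ∙ removeAt v i ∎))

-- Orthogonality between vectors over `L` and vectors over `F`.

module SplitCodewords {c ℓ q m} (E : FiniteFieldExtension c ℓ q m)
                      (Γ : FiniteFieldExtension.FBasis E) where
  open FiniteFieldExtension E
  open RankMetric E Γ
  private
    module FD = DotProduct F
    module LD = DotProduct L
  open FD using () renaming (_∙_ to _∙ᶠ_; _⊙_ to _⊙ᶠ_)
  open LD using (_∙_; _⊙_)

  _≟F_ : Decidable F._≈_
  _≟F_ = Fin.inj⇒≟ (Inverse⇒Injection F-order)

  _≟L_ : Decidable L._≈_
  _≟L_ = Fin.inj⇒≟ (Inverse⇒Injection L-order)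

  open FieldLinearAlgebra F F-isField _≟F_ using (span-or-separate; ∃-GL-columns)

  ι-∙ : ∀ {n} (x y : Vector F.Carrier n) → ι (x ∙ᶠ y) L.≈ (ι ∘ x) ∙ (ι ∘ y)
  ι-∙ {zero}  x y = ι.0#-homo
  ι-∙ {suc n} x y = L.trans (ι.+-homo _ _)
    (L.+-cong (ι.*-homo (x zero) (y zero)) (ι-∙ (x ∘ suc) (y ∘ suc)))

  ι-identityMatrix : ∀ {n} (i j : Fin n) →
                     ι (identityMatrix F n i j) L.≈ identityMatrix L n i j
  ι-identityMatrix i j with i Fin.≟ j
  ... | yes _ = ι.1#-homo
  ... | no  _ = ι.0#-homo

  ι-⊙-assoc : ∀ {n s} (x : Vector L.Carrier n) (M : Matrix F.Carrier n s) t →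
              x ∙ (λ i → ι (M i ∙ᶠ t)) L.≈ (x ⊙ (λ i j → ι (M i j))) ∙ (ι ∘ t)
  ι-⊙-assoc x M t = L.trans (LD.∙-congˡ (λ i → ι-∙ (M i) t))
                            (L.sym (LD.⊙-∙-assoc x (λ i j → ι (M i j)) (ι ∘ t)))

  infix 4 _⊥_
  _⊥_ : ∀ {n} → Vector L.Carrier n → Pred (Vector F.Carrier n) ℓ
  x ⊥ a = x ∙ (ι ∘ a) L.≈ L.0#

  -- Since `a` has entries in `F`, the coordinates of `Σ x_l a_l` in the basis `Γ` are the pairings
  -- of `a` with the rows of `Mat x`. By independence of `Γ`, `x ⊥ a` then means that `a` is
  -- orthogonal to all these rows.
  x∙a≈γ∙Mat : ∀ {n} (x : Vector L.Carrier n) a →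
              x ∙ (ι ∘ a) L.≈ (λ i → ι (Mat x i ∙ᶠ a)) ∙ proj₁ Γ
  x∙a≈γ∙Mat x a = begin
    x ∙ (ι ∘ a)
      ≈⟨ LD.∙-congʳ (λ l → L.trans (proj₂ (proj₂ (proj₂ (proj₂ Γ)) {x l} _))
                                   (LD.∙-comm (λ i → ι (Mat x i l)) γ)) ⟩
    (γ ⊙ (λ i j → ι (Mat x i j))) ∙ (ι ∘ a)
      ≈⟨ ι-⊙-assoc γ (Mat x) a ⟨
    γ ∙ (λ i → ι (Mat x i ∙ᶠ a))
      ≈⟨ LD.∙-comm γ _ ⟩
    (λ i → ι (Mat x i ∙ᶠ a)) ∙ γ ∎
    where
    open SetoidReasoning L.setoid
    γ = proj₁ Γ

  ⊥⇒Mat∙ : ∀ {n} (x : Vector L.Carrier n) a → x ⊥ a → ∀ i → Mat x i ∙ᶠ a F.≈ F.0#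
  ⊥⇒Mat∙ x a x⊥a = proj₁ (proj₂ Γ) (λ i → Mat x i ∙ᶠ a) (L.trans (L.sym (x∙a≈γ∙Mat x a)) x⊥a)

  Mat∙⇒⊥ : ∀ {n} (x : Vector L.Carrier n) a → (∀ i → Mat x i ∙ᶠ a F.≈ F.0#) → x ⊥ a
  Mat∙⇒⊥ x a Mat∙a≈0 = L.trans (x∙a≈γ∙Mat x a)
    (LD.∙-zeroˡ (proj₁ Γ) (λ i → L.trans (ι.⟦⟧-cong (Mat∙a≈0 i)) ι.0#-homo))

  ⊥-σ : ∀ {n} (x : Vector L.Carrier n) {h a} → x ⊥ a → h ∈ σ x → h ∙ᶠ a F.≈ F.0#
  ⊥-σ x {h} {a} x⊥a h∈σ = F.trans (FD.∙-comm h a)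
    (FD.Span⊆orthogonal (λ i → F.trans (FD.∙-comm a (Mat x i)) (⊥⇒Mat∙ x a x⊥a i)) h h∈σ)

  -- Disjoint supports, spanning orthogonals and orthogonal columns.

  module _ {n} (x y : Vector L.Carrier n) where
    DisjointSupports : Set (c ⊔ ℓ)
    DisjointSupports = (σ x ∩ σ y) ≐ LinearAlgebra.IsZero (F^ n)

    OrthogonalsSpan : Set (c ⊔ ℓ)
    OrthogonalsSpan = (a : Vector F.Carrier n) → ∃₂ λ b b′ → (∀ i → a i F.≈ b i F.+ b′ i) × x ⊥ b × y ⊥ b′

    OrthogonalColumns : Set (c ⊔ ℓ)
    OrthogonalColumns = ∃ λ (A : GL F n) → ∀ j →
      x ⊥ column (GL.matrix A) j ⊎ y ⊥ column (GL.matrix A) j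

    -- A splitting of a is a solution b of the linear system with matrix (Mat x; Mat y) and
    -- right-hand side (0; Mat y a); a certificate (z₁, z₂) of its insolvability would give the
    -- element z₂ Mat y = - z₁ Mat x of σ x ∩ σ y, not orthogonal to a.
    disjointSupports⇒orthogonalsSpan : DisjointSupports → OrthogonalsSpan
    disjointSupports⇒orthogonalsSpan disjoint a
      with span-or-separate (column N) r
      where
      N : Matrix F.Carrier (m +ℕ m) n
      N = Mat x ++ Mat y
      r : Vector F.Carrier (m +ℕ m)
      r = (λ _ → F.0#) ++ (λ i → Mat y i ∙ᶠ a)
    ... | inj₁ (b , r≈Nb) = b , (λ i → a i F.- b i)
        , (λ i → F.sym (a+[b-a]≈b (b i) (a i)))
        , Mat∙⇒⊥ x b (λ i → F.trans (FD.∙-comm (Mat x i) b) (Nb-top i))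
        , Mat∙⇒⊥ y (λ i → a i F.- b i) (λ i → begin
            Mat y i ∙ᶠ (λ j → a j F.- b j)           ≈⟨ FD.∙-+ʳ (Mat y i) a (λ j → F.- b j) ⟩
            Mat y i ∙ᶠ a F.+ Mat y i ∙ᶠ (λ j → F.- b j) ≈⟨ F.+-congˡ (FD.∙-negʳ (Mat y i) b) ⟩
            Mat y i ∙ᶠ a F.- Mat y i ∙ᶠ b            ≈⟨ F.+-congˡ (F.-‿cong (F.trans (FD.∙-comm (Mat y i) b) (Nb-bottom i))) ⟩
            Mat y i ∙ᶠ a F.- Mat y i ∙ᶠ a            ≈⟨ F.-‿inverseʳ _ ⟩
            F.0#                                      ∎)
      where
      open SetoidReasoning F.setoid
      a+[b-a]≈b : ∀ a b → a F.+ (b F.- a) F.≈ b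
      a+[b-a]≈b a b = F.trans (F.sym (F.+-assoc a b (F.- a))) (xyx⁻¹≈y a b)
        where open AbelianGroupProperties F.+-abelianGroup using (xyx⁻¹≈y)
      Nb-top : ∀ i → b ∙ᶠ Mat x i F.≈ F.0#
      Nb-top i = begin
        b ∙ᶠ Mat x i                     ≡⟨ ≡.cong (b ∙ᶠ_) (lookup-++ˡ (Mat x) (Mat y) i) ⟨
        b ∙ᶠ (Mat x ++ Mat y) (i ↑ˡ m)   ≈⟨ r≈Nb (i ↑ˡ m) ⟨
        _                                ≡⟨ lookup-++ˡ (λ _ → F.0#) (λ i → Mat y i ∙ᶠ a) i ⟩
        F.0#                             ∎
      Nb-bottom : ∀ i → b ∙ᶠ Mat y i F.≈ Mat y i ∙ᶠ a
      Nb-bottom i = begin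
        b ∙ᶠ Mat y i                     ≡⟨ ≡.cong (b ∙ᶠ_) (lookup-++ʳ (Mat x) (Mat y) i) ⟨
        b ∙ᶠ (Mat x ++ Mat y) (m ↑ʳ i)   ≈⟨ r≈Nb (m ↑ʳ i) ⟨
        _                                ≡⟨ lookup-++ʳ {m = m} (λ _ → F.0#) (λ i → Mat y i ∙ᶠ a) i ⟩
        Mat y i ∙ᶠ a                     ∎
    ... | inj₂ (z , zN≈0 , r∙z≉0) = contradiction r∙z≈0 r∙z≉0
      where
      open SetoidReasoning F.setoid
      z₁ z₂ : Vector F.Carrier m
      z₁ = z ∘ (_↑ˡ m)
      z₂ = z ∘ (m ↑ʳ_)
      h : Vector F.Carrier n
      h = z₂ ⊙ᶠ Mat y
      z₁Mat+h≈0 : ∀ l → (z₁ ⊙ᶠ Mat x) l F.+ h l F.≈ F.0#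
      z₁Mat+h≈0 l = begin
        (z₁ ⊙ᶠ Mat x) l F.+ h l
          ≈⟨ F.+-cong
               (FD.∙-congˡ (λ i → F.reflexive (≡.cong-app (lookup-++ˡ (Mat x) (Mat y) i) l)))
               (FD.∙-congˡ (λ i → F.reflexive (≡.cong-app (lookup-++ʳ (Mat x) (Mat y) i) l))) ⟨
        _ ≈⟨ FD.∙-split m z (column (Mat x ++ Mat y) l) ⟨
        z ∙ᶠ column (Mat x ++ Mat y) l
          ≈⟨ FD.∙-comm z _ ⟩
        column (Mat x ++ Mat y) l ∙ᶠ z
          ≈⟨ zN≈0 l ⟩
        F.0# ∎
      h∈σy : h ∈ σ y
      h∈σy = z₂ , λ l → F.sym (FD.lincomb≈⊙ z₂ (Mat y) l)
      h∈σx : h ∈ σ x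
      h∈σx = (λ i → F.- z₁ i) , λ l → begin
        h l                              ≈⟨ +-inverseʳ-unique _ _ (z₁Mat+h≈0 l) ⟩
        F.- (z₁ ⊙ᶠ Mat x) l              ≈⟨ FD.∙-negˡ z₁ (column (Mat x) l) ⟨
        ((λ i → F.- z₁ i) ⊙ᶠ Mat x) l    ≈⟨ FD.lincomb≈⊙ _ (Mat x) l ⟨
        _                                ∎
        where open RingProperties F.ring using (+-inverseʳ-unique)
      r∙z≈0 : ((λ _ → F.0#) ++ (λ i → Mat y i ∙ᶠ a)) ∙ᶠ z F.≈ F.0#
      r∙z≈0 = begin
        ((λ _ → F.0#) ++ (λ i → Mat y i ∙ᶠ a)) ∙ᶠ z
          ≈⟨ FD.∙-split m _ z ⟩
        _ ≈⟨ F.+-cong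
               (FD.∙-zeroˡ z₁ (λ i → F.reflexive
                 (lookup-++ˡ (λ _ → F.0#) (λ i → Mat y i ∙ᶠ a) i)))
               (FD.∙-congʳ {y = z₂} (λ i → F.reflexive
                 (lookup-++ʳ {m = m} (λ _ → F.0#) (λ i → Mat y i ∙ᶠ a) i))) ⟩
        F.0# F.+ (λ i → Mat y i ∙ᶠ a) ∙ᶠ z₂
          ≈⟨ F.+-identityˡ _ ⟩
        (λ i → Mat y i ∙ᶠ a) ∙ᶠ z₂
          ≈⟨ FD.∙-comm _ z₂ ⟩
        z₂ ∙ᶠ (λ i → Mat y i ∙ᶠ a)
          ≈⟨ FD.⊙-∙-assoc z₂ (Mat y) a ⟨
        h ∙ᶠ a
          ≈⟨ FD.∙-zeroˡ a (proj₁ disjoint (h∈σx , h∈σy)) ⟩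
        F.0# ∎

    -- A vector of both supports is orthogonal to both parts of every splitting, hence to every unit
    -- vector.
    orthogonalsSpan⇒disjointSupports : OrthogonalsSpan → DisjointSupports
    orthogonalsSpan⇒disjointSupports split =
      (λ {h} (h∈σx , h∈σy) l →
        let b , b′ , eₗ≈b+b′ , x⊥b , y⊥b′ = split (column (identityMatrix F n) l) in begin
        h l                                    ≈⟨ FD.⊙-identityʳ h l ⟨
        h ∙ᶠ column (identityMatrix F n) l     ≈⟨ FD.∙-congˡ eₗ≈b+b′ ⟩
        h ∙ᶠ (λ i → b i F.+ b′ i)              ≈⟨ FD.∙-+ʳ h b b′ ⟩
        h ∙ᶠ b F.+ h ∙ᶠ b′                     ≈⟨ F.+-cong (⊥-σ x x⊥b h∈σx) (⊥-σ y y⊥b′ h∈σy) ⟩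
        F.0# F.+ F.0#                          ≈⟨ F.+-identityˡ F.0# ⟩
        F.0#                                   ∎) ,
      λ h≈0 → 0∈σ x h≈0 , 0∈σ y h≈0
      where
      open SetoidReasoning F.setoid
      0∈σ : ∀ x {h} → (∀ i → h i F.≈ F.0#) → h ∈ σ x
      0∈σ x h≈0 = (λ _ → F.0#) , λ l → F.trans (h≈0 l) (F.sym
        (F.trans (FD.lincomb≈⊙ _ (Mat x) l) (FD.∙-zeroˡ (column (Mat x) l) (λ _ → F.refl))))

    -- If `z ∙ w` is nonzero and `w = b + b′` is split, then one of `z ∙ b` and `z ∙ b′` is nonzero.
    -- This is the condition under which columns can be exchanged.
    orthogonalsSpan⇒orthogonalColumns : OrthogonalsSpan → OrthogonalColumns
    orthogonalsSpan⇒orthogonalColumns split = ∃-GL-columns (λ v → x ⊥ v ⊎ y ⊥ v) spans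
      where
      spans : ∀ z w → ¬ (z ∙ᶠ w F.≈ F.0#) →
              ∃ λ v → (x ⊥ v ⊎ y ⊥ v) × ¬ (z ∙ᶠ v F.≈ F.0#)
      spans z w z∙w≉0 with b , b′ , w≈b+b′ , x⊥b , y⊥b′ ← split w with (z ∙ᶠ b) ≟F F.0#
      ... | no  z∙b≉0 = b , inj₁ x⊥b , z∙b≉0
      ... | yes z∙b≈0 = b′ , inj₂ y⊥b′ , λ z∙b′≈0 → z∙w≉0
        (F.trans (FD.∙-congˡ w≈b+b′) (F.trans (FD.∙-+ʳ z b b′)
          (F.trans (F.+-cong z∙b≈0 z∙b′≈0) (F.+-identityˡ F.0#))))

  GL-coordinates : ∀ {n} (A : GL F n) a i →
                   GL.matrix A i ∙ᶠ (λ l → GL.matrix⁻¹ A l ∙ᶠ a) F.≈ a i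
  GL-coordinates A a i = F.trans (F.sym (FD.⊙-∙-assoc (GL.matrix A i) (GL.matrix⁻¹ A) a))
    (F.trans (FD.∙-congʳ (GL.inverseʳ A i)) (FD.∙-identityˡ i a))

  -- Expand `a` in the columns of `A`, with coefficients `t`, and collect the terms whose column is
  -- assigned to `x` in one part and the others in the second.
  orthogonalColumns⇒orthogonalsSpan : ∀ {n} (x y : Vector L.Carrier n) →
                                      OrthogonalColumns x y → OrthogonalsSpan x y
  orthogonalColumns⇒orthogonalsSpan {n} x y (A , ⊥col) a =
    (λ i → GL.matrix A i ∙ᶠ t₁) , (λ i → GL.matrix A i ∙ᶠ t₂) ,
    (λ i → F.trans (F.sym (GL-coordinates A a i))
      (F.trans (FD.∙-congˡ t≈t₁+t₂) (FD.∙-+ʳ (GL.matrix A i) t₁ t₂))) ,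
    L.trans (ι-⊙-assoc x (GL.matrix A) t₁) (LD.∙-zero x⊥col⊎t₁≈0) ,
    L.trans (ι-⊙-assoc y (GL.matrix A) t₂) (LD.∙-zero y⊥col⊎t₂≈0)
    where
    t t₁ t₂ : Vector F.Carrier n
    t l = GL.matrix⁻¹ A l ∙ᶠ a
    t₁ j = [ const (t j) , const F.0# ] (⊥col j)
    t₂ j = [ const F.0# , const (t j) ] (⊥col j)
    t≈t₁+t₂ : ∀ j → t j F.≈ t₁ j F.+ t₂ j
    t≈t₁+t₂ j with ⊥col j
    ... | inj₁ _ = F.sym (F.+-identityʳ (t j))
    ... | inj₂ _ = F.sym (F.+-identityˡ (t j))
    x⊥col⊎t₁≈0 : ∀ j → x ⊥ column (GL.matrix A) j ⊎ ι (t₁ j) L.≈ L.0#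
    x⊥col⊎t₁≈0 j with ⊥col j
    ... | inj₁ x⊥col = inj₁ x⊥col
    ... | inj₂ _     = inj₂ ι.0#-homo
    y⊥col⊎t₂≈0 : ∀ j → y ⊥ column (GL.matrix A) j ⊎ ι (t₂ j) L.≈ L.0#
    y⊥col⊎t₂≈0 j with ⊥col j
    ... | inj₁ _     = inj₂ ι.0#-homo
    ... | inj₂ y⊥col = inj₁ y⊥col

  -- Each unit vector is a combination of the columns of `A`, with coefficients from `matrix⁻¹`, so
  -- `x` pairs to zero with all of them.
  GL-injective : ∀ {n} (A : GL F n) x → (∀ j → x ⊥ column (GL.matrix A) j) →
                 ∀ l → x l L.≈ L.0#
  GL-injective {n} A x x⊥cols l = begin
    x l
      ≈⟨ LD.⊙-identityʳ x l ⟨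
    x ∙ column (identityMatrix L n) l
      ≈⟨ LD.∙-congˡ (λ i → ι-identityMatrix i l) ⟨
    x ∙ (ι ∘ eₗ)
      ≈⟨ LD.∙-congˡ (λ i → ι.⟦⟧-cong (GL-coordinates A eₗ i)) ⟨
    x ∙ (λ i → ι (GL.matrix A i ∙ᶠ (λ k → GL.matrix⁻¹ A k ∙ᶠ eₗ)))
      ≈⟨ ι-⊙-assoc x (GL.matrix A) (λ k → GL.matrix⁻¹ A k ∙ᶠ eₗ) ⟩
    (x ⊙ (λ i j → ι (GL.matrix A i j))) ∙ (λ k → ι (GL.matrix⁻¹ A k ∙ᶠ eₗ))
      ≈⟨ LD.∙-zeroˡ _ x⊥cols ⟩
    L.0# ∎
    where
    open SetoidReasoning L.setoid
    eₗ = column (identityMatrix F n) l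

  -- The generator matrix, and the statements as exclusions of pairs of codewords.

  module _ {n k d p} {C : Pred (Vector L.Carrier n) p} (isCode : IsCode n k d C)
           {G : Matrix L.Carrier k n} (generates : IsGeneratorMatrix G C) where
    open IsCode isCode using (dimension; 1≤k)
    open FieldLinearAlgebra L L-isField _≟L_
    open SetoidReasoning L.setoid

    encode∈C : ∀ u → u ⊙ G ∈ C
    encode∈C u = proj₁ generates (u , λ l → L.sym (LD.lincomb≈⊙ u G l))

    decode : ∀ {x} → x ∈ C → ∃ λ u → ∀ l → x l L.≈ (u ⊙ G) l
    decode x∈C with u , x≈uG ← proj₂ generates x∈C =
      u , λ l → L.trans (x≈uG l) (LD.lincomb≈⊙ u G l)

    -- The matrix T of a basis D of C with respect to the rows of G is invertible.
    encode-injective : ∀ u → IsZero (u ⊙ G) → IsZero u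
    encode-injective u uG≈0 j = L.trans (L.sym (vT≈u j)) (LD.∙-zeroˡ (column T j) v≈0)
      where
      D : Matrix L.Carrier k n
      D = proj₁ dimension
      D∈C : ∀ i → D i ∈ C
      D∈C i = proj₁ (proj₂ (proj₂ dimension)) (identityMatrix L k i , λ l → L.sym
        (L.trans (LD.lincomb≈⊙ (identityMatrix L k i) D l) (LD.∙-identityˡ i (column D l))))
      T : Matrix L.Carrier k k
      T i = proj₁ (decode (D∈C i))
      vD≈vTG : ∀ v l → LinearAlgebra.lincomb (L^ n) v D l L.≈ ((v ⊙ T) ⊙ G) l
      vD≈vTG v l = begin
        LinearAlgebra.lincomb (L^ n) v D l  ≈⟨ LD.lincomb≈⊙ v D l ⟩
        v ∙ column D l                      ≈⟨ LD.∙-congˡ (λ i → proj₂ (decode (D∈C i)) l) ⟩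
        v ∙ (λ i → T i ∙ column G l)        ≈⟨ LD.⊙-∙-assoc v T (column G l) ⟨
        ((v ⊙ T) ⊙ G) l                     ∎
      vTG≈0⇒v≈0 : ∀ v → IsZero ((v ⊙ T) ⊙ G) → IsZero v
      vTG≈0⇒v≈0 v vTG≈0 = proj₁ (proj₂ dimension) v (λ l → L.trans (vD≈vTG v l) (vTG≈0 l))
      T-injective : ∀ v → IsZero (v ⊙ T) → IsZero v
      T-injective v vT≈0 = vTG≈0⇒v≈0 v (λ l → LD.∙-zeroˡ (column G l) vT≈0)
      -- Surjectivity of `T` writes `u` as `v T`. Then `v D = u G = 0`, so `v = 0` by independence
      -- of `D`, and `u = 0`.
      v : Vector L.Carrier k
      v = proj₁ (injective⇒surjective T T-injective u)
      vT≈u : ∀ j → (v ⊙ T) j L.≈ u j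
      vT≈u = proj₂ (injective⇒surjective T T-injective u)
      v≈0 : IsZero v
      v≈0 = vTG≈0⇒v≈0 v (λ l → L.trans (LD.∙-congʳ {y = column G l} vT≈u) (uG≈0 l))

    -- The common form of the four statements. For `DisjointSupports` it unfolds to
    -- `RankIntersecting C`.
    Excludes : ∀ {r} → (Vector L.Carrier n → Vector L.Carrier n → Set r) → Set (c ⊔ ℓ ⊔ p ⊔ r)
    Excludes R = ∀ x y → x ∈ C → y ∈ C → ¬ IsZero x → ¬ IsZero y → ¬ R x y

    Excludes-map : ∀ {r r′} {R : Vector L.Carrier n → Vector L.Carrier n → Set r}
                   {R′ : Vector L.Carrier n → Vector L.Carrier n → Set r′} →
                   (∀ x y → R′ x y → R x y) → Excludes R → Excludes R′
    Excludes-map R′⇒R excludes x y x∈C y∈C x≉0 y≉0 r′ =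
      excludes x y x∈C y∈C x≉0 y≉0 (R′⇒R x y r′)

    -- Entry `j` of `x A` is the pairing of `x` with column `j` of `A`. Hence `x A` and `y A` share
    -- no nonzero coordinate exactly when every column is orthogonal to `x` or to `y`.
    hammingIntersecting⇔ : ((A : GL F n) → HammingIntersecting (C ·ᶜ A)) ⇔ Excludes OrthogonalColumns
    hammingIntersecting⇔ = mk⇔ to from
      where
      to : ((A : GL F n) → HammingIntersecting (C ·ᶜ A)) → Excludes OrthogonalColumns
      to hamming x y x∈C y∈C x≉0 y≉0 (A , ⊥cols)
        with i , xA≉0 , yA≉0 ← hamming A
               (λ j → x ∙ (ι ∘ column (GL.matrix A) j)) (λ j → y ∙ (ι ∘ column (GL.matrix A) j))
               (x , x∈C , λ _ → L.refl) (y , y∈C , λ _ → L.refl)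
               (x≉0 ∘ GL-injective A x) (y≉0 ∘ GL-injective A y)
        = [ xA≉0 , yA≉0 ] (⊥cols i)
      from : Excludes OrthogonalColumns → (A : GL F n) → HammingIntersecting (C ·ᶜ A)
      from excludes A x y (x′ , x′∈C , x≈x′A) (y′ , y′∈C , y≈y′A) x≉0 y≉0
        -- The goal is an actual coordinate while the hypothesis is a negation; a finite search with
        -- decidable equality bridges the two.
        with Fin.any? (λ i → ¬? (x i ≟L L.0#) ×-dec ¬? (y i ≟L L.0#))
      ... | yes common = common
      ... | no  none   = contradiction (A , ⊥cols)
        (excludes x′ y′ x′∈C y′∈C (x≉0 ∘ nonzero x≈x′A) (y≉0 ∘ nonzero y≈y′A))
        where
        nonzero : ∀ {z z′} → (∀ j → z j L.≈ z′ ∙ (ι ∘ column (GL.matrix A) j)) →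
                  IsZero z′ → IsZero z
        nonzero z≈z′A z′≈0 j = L.trans (z≈z′A j) (LD.∙-zeroˡ _ z′≈0)
        ⊥cols : ∀ j → x′ ⊥ column (GL.matrix A) j ⊎ y′ ⊥ column (GL.matrix A) j
        ⊥cols j with x j ≟L L.0# | y j ≟L L.0#
        ... | yes xⱼ≈0 | _        = inj₁ (L.trans (L.sym (x≈x′A j)) xⱼ≈0)
        ... | no  _    | yes yⱼ≈0 = inj₂ (L.trans (L.sym (y≈y′A j)) yⱼ≈0)
        ... | no  xⱼ≉0 | no  yⱼ≉0 = contradiction (j , xⱼ≉0 , yⱼ≉0) none

    encode-⊥ : ∀ u a → (u ⊙ G) ∙ (ι ∘ a) L.≈ u ∙ (λ i → G i ∙ (ι ∘ a))
    encode-⊥ u a = LD.⊙-∙-assoc u G (ι ∘ a)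

    decode-⊥ : ∀ {x u} → (∀ l → x l L.≈ (u ⊙ G) l) → ∀ a →
               x ∙ (ι ∘ a) L.≈ u ∙ (λ i → G i ∙ (ι ∘ a))
    decode-⊥ {u = u} x≈uG a = L.trans (LD.∙-congʳ x≈uG) (encode-⊥ u a)

    decode-nonzero : ∀ {x u} → (∀ l → x l L.≈ (u ⊙ G) l) → ¬ IsZero x → ¬ IsZero u
    decode-nonzero x≈uG x≉0 u≈0 =
      x≉0 (λ l → L.trans (x≈uG l) (LD.∙-zeroˡ (column G l) u≈0))

    -- Column `j` of `G · A` is `G` applied to column `j` of `A`, so it lies in `Kernel u` exactly
    -- when `u ⊙ G` is orthogonal to that column of `A`. A given hyperplane is replaced by a
    -- functional vanishing on it, whose codeword is nonzero by `encode-injective`.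
    notInTwoHyperplanes⇔ : (nondegenerate : Nondegenerate C) →
      ((A : GL F n) → ¬ ContainedInTwoHyperplanes L L-isField (columnPoints nondegenerate generates A))
      ⇔ Excludes OrthogonalColumns
    notInTwoHyperplanes⇔ nondegenerate = mk⇔
      (λ notIn x y x∈C y∈C x≉0 y≉0 (A , ⊥cols) →
        let u , x≈uG = decode x∈C
            w , y≈wG = decode y∈C
        in notIn A
          ( Kernel u , Kernel w
          , kernel-isHyperplane 1≤k u (decode-nonzero x≈uG x≉0)
          , kernel-isHyperplane 1≤k w (decode-nonzero y≈wG y≉0)
          , λ j → Sum.map
              (λ x⊥col → lift (L.trans (L.sym (decode-⊥ x≈uG _)) x⊥col))
              (λ y⊥col → lift (L.trans (L.sym (decode-⊥ y≈wG _)) y⊥col)) (⊥cols j)))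
      λ excludes A (H₁ , H₂ , isH₁ , isH₂ , cols∈H) →
        let u , u≉0 , u⊥H₁ = hyperplane⇒functional 1≤k isH₁
            w , w≉0 , w⊥H₂ = hyperplane⇒functional 1≤k isH₂
        in excludes (u ⊙ G) (w ⊙ G) (encode∈C u) (encode∈C w)
             (u≉0 ∘ encode-injective u) (w≉0 ∘ encode-injective w)
             (A , λ j → Sum.map (λ col∈H₁ → L.trans (encode-⊥ u _) (u⊥H₁ col∈H₁))
                                (λ col∈H₂ → L.trans (encode-⊥ w _) (w⊥H₂ col∈H₂)) (cols∈H j))

    lincomb-columns : ∀ a i → LinearAlgebra.lincomb (L^ k -over-F) a (column G) i L.≈ G i ∙ (ι ∘ a)
    lincomb-columns a i = L.trans (LD.lincomb≈⊙ (ι ∘ a) (column G) i) (LD.∙-comm (ι ∘ a) (G i))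

    G∙-+ : ∀ {a b b′ : Vector F.Carrier n} → (∀ i → a i F.≈ b i F.+ b′ i) → ∀ i →
           G i ∙ (ι ∘ a) L.≈ G i ∙ (ι ∘ b) L.+ G i ∙ (ι ∘ b′)
    G∙-+ {b = b} {b′} a≈b+b′ i = L.trans
      (LD.∙-congˡ (λ l → L.trans (ι.⟦⟧-cong (a≈b+b′ l)) (ι.+-homo (b l) (b′ l))))
      (LD.∙-+ʳ (G i) (ι ∘ b) (ι ∘ b′))

    -- The system is the image of `F^n` under `a ↦ G a`, and `u ⊙ G ⊥ a` says that `G a` lies in
    -- `Kernel u`. Thus splittings of vectors `a` correspond to splittings of vectors `G a`.
    notTwoSpannable⇔ : (¬ TwoSpannable (system G)) ⇔ Excludes OrthogonalsSpan
    notTwoSpannable⇔ = mk⇔ to from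
      where
      to : ¬ TwoSpannable (system G) → Excludes OrthogonalsSpan
      to notTwoSpannable x y x∈C y∈C x≉0 y≉0 split
        with u , x≈uG ← decode x∈C with w , y≈wG ← decode y∈C = notTwoSpannable
          ( Kernel u , Kernel w
          , kernel-isHyperplane 1≤k u (decode-nonzero x≈uG x≉0)
          , kernel-isHyperplane 1≤k w (decode-nonzero y≈wG y≉0)
          , (λ (a , v≈Ga) →
              let b , b′ , a≈b+b′ , x⊥b , y⊥b′ = split a in
              (λ i → G i ∙ (ι ∘ b)) , (λ i → G i ∙ (ι ∘ b′))
              , (lift (L.trans (L.sym (decode-⊥ x≈uG b)) x⊥b) , b , λ i → L.sym (lincomb-columns b i))
              , (lift (L.trans (L.sym (decode-⊥ y≈wG b′)) y⊥b′) , b′ , λ i → L.sym (lincomb-columns b′ i))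
              , λ i → L.trans (v≈Ga i) (L.trans (lincomb-columns a i) (G∙-+ a≈b+b′ i)))
          -- The reverse inclusion: a sum of two elements of the system is in the system, with the
          -- coefficients added.
          , λ (_ , _ , (_ , b , y≈Gb) , (_ , b′ , z≈Gb′) , v≈y+z) →
              (λ l → b l F.+ b′ l) , λ i → L.trans (v≈y+z i) (L.trans
                (L.+-cong (L.trans (y≈Gb i) (lincomb-columns b i))
                          (L.trans (z≈Gb′ i) (lincomb-columns b′ i)))
                (L.trans (L.sym (G∙-+ (λ _ → F.refl) i)) (L.sym (lincomb-columns _ i)))))
      -- If G a = y + z with y ∈ H₁ and z = G b′ ∈ H₂, then G (a - b′) = y.
      from : Excludes OrthogonalsSpan → ¬ TwoSpannable (system G)
      from excludes (H₁ , H₂ , isH₁ , isH₂ , U⊆ , _)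
        with u , u≉0 , u⊥H₁ ← hyperplane⇒functional 1≤k isH₁
        with w , w≉0 , w⊥H₂ ← hyperplane⇒functional 1≤k isH₂ =
        excludes (u ⊙ G) (w ⊙ G) (encode∈C u) (encode∈C w)
          (u≉0 ∘ encode-injective u) (w≉0 ∘ encode-injective w) split
        where
        split : OrthogonalsSpan (u ⊙ G) (w ⊙ G)
        split a with y , z , (y∈H₁ , _) , (z∈H₂ , b′ , z≈Gb′) , Ga≈y+z
                       ← U⊆ {λ i → G i ∙ (ι ∘ a)} (a , λ i → L.sym (lincomb-columns a i)) =
          (λ i → a i F.- b′ i) , b′ , a≈a-b′+b′
          , L.trans (encode-⊥ u (λ i → a i F.- b′ i)) (L.trans (LD.∙-congˡ Ga-Gb′≈y) (u⊥H₁ y∈H₁))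
          , L.trans (encode-⊥ w b′) (L.trans (LD.∙-congˡ (λ i → L.sym (z≈G i))) (w⊥H₂ z∈H₂))
          where
          z≈G : ∀ i → z i L.≈ G i ∙ (ι ∘ b′)
          z≈G i = L.trans (z≈Gb′ i) (lincomb-columns b′ i)
          a≈a-b′+b′ : ∀ i → a i F.≈ a i F.- b′ i F.+ b′ i
          a≈a-b′+b′ i = F.sym (F.trans (F.+-assoc _ _ _)
            (F.trans (F.+-congˡ (F.-‿inverseˡ (b′ i))) (F.+-identityʳ (a i))))
          Ga-Gb′≈y : ∀ i → G i ∙ (ι ∘ (λ l → a l F.- b′ l)) L.≈ y i
          Ga-Gb′≈y i = +-cancelʳ (z i) _ _ (begin
            G i ∙ (ι ∘ (λ l → a l F.- b′ l)) L.+ z i                ≈⟨ L.+-congˡ (z≈G i) ⟩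
            G i ∙ (ι ∘ (λ l → a l F.- b′ l)) L.+ G i ∙ (ι ∘ b′)     ≈⟨ G∙-+ a≈a-b′+b′ i ⟨
            G i ∙ (ι ∘ a)                                           ≈⟨ Ga≈y+z i ⟩
            y i L.+ z i                                             ∎)
            where open RingProperties L.ring using (+-cancelʳ)

theorem3p4 :
  ∀ {c ℓ p} (q m n k d : ℕ) → IsPrimePower q → 1 ≤ m → 1 ≤ n →
  (E : FiniteFieldExtension c ℓ q m) (Γ : FiniteFieldExtension.FBasis E) →
  let open FiniteFieldExtension E
      open RankMetric E Γ
  in
  (C : Pred (Vector L.Carrier n) p) → IsCode n k d C →
  (nondegenerate : Nondegenerate C) →
  (G : Matrix L.Carrier k n) (generates : IsGeneratorMatrix G C) →
  let rankIntersecting = RankIntersecting C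
      hammingIntersecting = (A : GL F n) → HammingIntersecting (C ·ᶜ A)
      notInTwoHyperplanes = (A : GL F n) → ¬ ContainedInTwoHyperplanes L L-isField (columnPoints nondegenerate generates A)
      notTwoSpannable = ¬ TwoSpannable (system G)
  in
  (rankIntersecting ⇔ hammingIntersecting) × (hammingIntersecting ⇔ notInTwoHyperplanes) × (notInTwoHyperplanes ⇔ notTwoSpannable)
theorem3p4 q m n k d _ _ _ E Γ C isCode nondegenerate G generates =
  -- `Excludes OrthogonalColumns` is the hub through which the equivalences are composed; `spans`
  -- leads from it to `Excludes OrthogonalsSpan` for the last one.
  ⇔-sym hamming ⇔-∘ rank , ⇔-sym hyperplanes ⇔-∘ hamming , ⇔-sym spannable ⇔-∘ (spans ⇔-∘ hyperplanes)
  where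
  open FiniteFieldExtension E
  open RankMetric E Γ
  open SplitCodewords E Γ
  -- Exclusion is contravariant, so each direction is given by the implication between the excluded
  -- relations in the opposite direction.
  rank = mk⇔
    (Excludes-map isCode generates (λ x y →
      orthogonalsSpan⇒disjointSupports x y ∘ orthogonalColumns⇒orthogonalsSpan x y))
    (Excludes-map isCode generates (λ x y →
      orthogonalsSpan⇒orthogonalColumns x y ∘ disjointSupports⇒orthogonalsSpan x y))
  spans = mk⇔
    (Excludes-map isCode generates orthogonalsSpan⇒orthogonalColumns)
    (Excludes-map isCode generates orthogonalColumns⇒orthogonalsSpan)
  hamming = hammingIntersecting⇔ isCode generates
  hyperplanes = notInTwoHyperplanes⇔ isCode generates nondegenerate
  spannable = notTwoSpannable⇔ isCode generates
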